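{- For all integers $k\ge 1$ and $n\ge 0$, we have $\gamma_{1,4,5,5/2,3/2}^k(n)\ge 0$; that is, the coefficient of $q^n$ in $$\frac{1}{(1-q)(1-q^4)(1-q^5)}\sum_{j\notin[-k,k-1]}(-1)^{j+k}q^{j(5j+3)/2}$$ is nonnegative.
   Context: Identities are between formal power series in $q$. The sum $\sum_{j\notin[-k,k-1]}$ is over all integers $j\le -k-1$ and all integers $j\ge k$. In general $\gamma_{a,b,c,A,B}^k(n)$ is defined by $\frac{1}{(1-q^a)(1-q^b)(1-q^c)}\sum_{j\notin[-k,k-1]}(-1)^{j+k}q^{Aj^2+Bj}=\sum_{n\ge0}\gamma_{a,b,c,A,B}^k(n)q^n$. -}

module Defs where

open import Data.Bool.Base using (if_then_else_)
open import Data.Integer.Base as ℤ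
  using (ℤ; +_; -[1+_]; 0ℤ; 1ℤ; -1ℤ; ∣_∣)
import Data.Integer.Properties as ℤ
import Data.Integer.Tactic.RingSolver as ℤSolver
open import Data.List.Base
  using (List; []; _∷_; _++_; map; foldr; filter; zipWith; upTo; applyUpTo; applyDownFrom)
open import Data.Nat.Base as ℕ using (ℕ; zero; suc; NonZero; z≤n; s≤s)
open import Data.Nat.Divisibility using (_∣_; divides; ∣m∣n⇒∣m+n; m∣m*n)
import Data.Nat.DivMod as ℕ
import Data.Nat.Properties as ℕ
import Data.Nat.Tactic.RingSolver as ℕSolver
open import Data.Rational.Base as ℚ using (ℚ; toℚᵘ)
import Data.Rational.Properties as ℚ
open import Data.Rational.Unnormalised.Base as ℚᵘ using (mkℚᵘ; *≡*)
import Data.Rational.Unnormalised.Properties as ℚᵘ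
open import Data.Sum.Base using (_⊎_)
open import Function.Base using (_∘_)
open import Relation.Binary.PropositionalEquality
  using (_≡_; refl; sym; trans; cong; subst; module ≡-Reasoning)
open import Relation.Nullary.Decidable using (Dec; does; _⊎-dec_)

------------------------------------------------------------------------
-- Formal power series over ℤ, given by their coefficients

PowerSeries : Set
PowerSeries = ℕ → ℤ

sumℤ : List ℤ → ℤ
sumℤ = foldr ℤ._+_ 0ℤ

q^_ : ℕ → PowerSeries
(q^ m) n = if does (m ℕ.≟ n) then 1ℤ else 0ℤ

1-q^_ : ℕ → PowerSeries
(1-q^ m) n = (q^ 0) n ℤ.- (q^ m) n

infixl 7 _⊛_
_⊛_ : PowerSeries → PowerSeries → PowerSeries
(f ⊛ g) n = sumℤ (applyUpTo (λ i → f i ℤ.* g (n ℕ.∸ i)) (suc n))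

-- The multiplicative inverse of a series with constant term 1, computed by
-- solving f ⊛ f ⁻¹ = 1 for one coefficient at a time (see ⁻¹-inverseʳ).  It
-- is not meaningful for other constant terms.  The list  inverseCoeffs f n
-- holds the coefficients of f ⁻¹ of degrees n, …, 0, in this order.
infix 8 _⁻¹
mutual
  _⁻¹ : PowerSeries → PowerSeries
  (f ⁻¹) zero    = 1ℤ
  (f ⁻¹) (suc n) =
    ℤ.- sumℤ (zipWith ℤ._*_ (applyUpTo (f ∘ suc) (suc n)) (inverseCoeffs f n))

  inverseCoeffs : PowerSeries → ℕ → List ℤ
  inverseCoeffs f zero    = (f ⁻¹) zero ∷ []
  inverseCoeffs f (suc n) = (f ⁻¹) (suc n) ∷ inverseCoeffs f n

private
  inverseCoeffs-applyDownFrom : ∀ f n → inverseCoeffs f n ≡ applyDownFrom (f ⁻¹) (suc n)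
  inverseCoeffs-applyDownFrom f zero    = refl
  inverseCoeffs-applyDownFrom f (suc n) =
    cong ((f ⁻¹) (suc n) ∷_) (inverseCoeffs-applyDownFrom f n)

  zipWith-⊛ : ∀ f g n →
    sumℤ (zipWith ℤ._*_ (applyUpTo f (suc n)) (applyDownFrom g (suc n))) ≡ (f ⊛ g) n
  zipWith-⊛ f g zero    = refl
  zipWith-⊛ f g (suc n) = cong (λ x → f 0 ℤ.* g (suc n) ℤ.+ x) (zipWith-⊛ (f ∘ suc) g n)

⁻¹-inverseʳ : ∀ f → f 0 ≡ 1ℤ → ∀ n → (f ⊛ f ⁻¹) n ≡ (q^ 0) n
⁻¹-inverseʳ f f0≡1 zero    rewrite f0≡1 = refl
⁻¹-inverseʳ f f0≡1 (suc n)
  rewrite f0≡1 | inverseCoeffs-applyDownFrom f n | zipWith-⊛ (f ∘ suc) (f ⁻¹) n =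
  trans (cong (ℤ._+ s) (ℤ.*-identityˡ (ℤ.- s))) (ℤ.+-inverseˡ s)
  where
  s : ℤ
  s = ((f ∘ suc) ⊛ f ⁻¹) n

------------------------------------------------------------------------
-- The series γ

-- The hypothesis under which  Σ_j ± q^(A j² + B j)  is a formal power series:
-- the exponents are natural numbers and each of them occurs finitely often.
record QuadraticExponent (A B : ℚ) : Set where
  field
    exponent   : ℤ → ℕ
    exponent-≡ : ∀ j → (+ exponent j) ℚ./ 1 ≡
                       A ℚ.* ((j ℚ./ 1) ℚ.* (j ℚ./ 1)) ℚ.+ B ℚ.* (j ℚ./ 1)
    bound      : ℕ → ℕ
    ∣j∣≤bound  : ∀ j → ∣ j ∣ ℕ.≤ bound (exponent j)

Outside : ℕ → ℤ → Set
Outside k j = j ℤ.≤ ℤ.- (+ k) ℤ.- 1ℤ ⊎ + k ℤ.≤ j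

outside? : ∀ k j → Dec (Outside k j)
outside? k j = j ℤ.≤? ℤ.- (+ k) ℤ.- 1ℤ ⊎-dec + k ℤ.≤? j

-- The integers j with ∣ j ∣ ≤ N, each listed once.
window : ℕ → List ℤ
window N = map +_ (upTo (suc N)) ++ map -[1+_] (upTo N)

-- The parity of j + k, and hence (-1)^(j+k), depends only on ∣ j + k ∣.
[-1]^_ : ℤ → ℤ
[-1]^ m = -1ℤ ℤ.^ ∣ m ∣

-- The coefficient of q^n in the infinite sum is a finite sum: by ∣j∣≤bound,
-- every j whose exponent is n lies in the window of radius bound n.
thetaTail : ∀ {A B} → QuadraticExponent A B → ℕ → PowerSeries
thetaTail E k n =
  sumℤ (map (λ j → ([-1]^ (j ℤ.+ + k)) ℤ.* (q^ exponent j) n)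
            (filter (outside? k) (window (bound n))))
  where open QuadraticExponent E

denominator : ℕ → ℕ → ℕ → PowerSeries
denominator a b c = (1-q^ a) ⊛ (1-q^ b) ⊛ (1-q^ c)

denominator-0 : ∀ a b c .{{_ : NonZero a}} .{{_ : NonZero b}} .{{_ : NonZero c}} →
                denominator a b c 0 ≡ 1ℤ
denominator-0 (suc _) (suc _) (suc _) = refl

γ : ∀ a b c .{{_ : NonZero a}} .{{_ : NonZero b}} .{{_ : NonZero c}} →
    (A B : ℚ) → QuadraticExponent A B → ℕ → PowerSeries
γ a b c A B E k = denominator a b c ⁻¹ ⊛ thetaTail E k

------------------------------------------------------------------------
-- The exponents j(5j+3)/2

5/2 3/2 : ℚ
5/2 = + 5 ℚ./ 2
3/2 = + 3 ℚ./ 2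

-- The product j(5j+3) is nonnegative for every integer j, so ∣_∣ only
-- changes its type; it is also even.
j[5j+3]/2 : ℤ → ℕ
j[5j+3]/2 j = ∣ j ℤ.* (+ 5 ℤ.* j ℤ.+ + 3) ∣ ℕ./ 2

private
  2∣n[n+1] : ∀ n → 2 ∣ n ℕ.* suc n
  2∣n[n+1] zero    = divides 0 refl
  2∣n[n+1] (suc n) = subst (2 ∣_) (lem n)
    (∣m∣n⇒∣m+n (m∣m*n (suc n)) (2∣n[n+1] n))
    where
    lem : ∀ n → 2 ℕ.* suc n ℕ.+ n ℕ.* suc n ≡ suc n ℕ.* suc (suc n)
    lem = ℕSolver.solve-∀

  ∣5j+3∣ : ℤ → ℕ
  ∣5j+3∣ (+ n)    = 5 ℕ.* n ℕ.+ 3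
  ∣5j+3∣ -[1+ n ] = 5 ℕ.* n ℕ.+ 2

  5j+3-neg : ∀ n → + 5 ℤ.* -[1+ n ] ℤ.+ + 3 ≡ ℤ.- (+ (5 ℕ.* n ℕ.+ 2))
  5j+3-neg n = trans (lem (+ n)) (cong ℤ.-_ (cong (ℤ._+ + 2) (sym (ℤ.pos-* 5 n))))
    where
    lem : ∀ m → + 5 ℤ.* (ℤ.- (1ℤ ℤ.+ m)) ℤ.+ + 3 ≡ ℤ.- (+ 5 ℤ.* m ℤ.+ + 2)
    lem = ℤSolver.solve-∀

  product-≡ : ∀ j → j ℤ.* (+ 5 ℤ.* j ℤ.+ + 3) ≡ + (∣ j ∣ ℕ.* ∣5j+3∣ j)
  product-≡ (+ n) = trans
    (cong (λ m → + n ℤ.* (m ℤ.+ + 3)) (sym (ℤ.pos-* 5 n)))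
    (sym (ℤ.pos-* n (5 ℕ.* n ℕ.+ 3)))
  product-≡ -[1+ n ] = trans
    (cong (-[1+ n ] ℤ.*_) (5j+3-neg n))
    (trans (lem (+ suc n) (+ (5 ℕ.* n ℕ.+ 2))) (sym (ℤ.pos-* (suc n) _)))
    where
    lem : ∀ x y → ℤ.- x ℤ.* ℤ.- y ≡ x ℤ.* y
    lem = ℤSolver.solve-∀

  product-even : ∀ j → 2 ∣ ∣ j ∣ ℕ.* ∣5j+3∣ j
  product-even (+ n) = subst (2 ∣_) (lem n)
    (∣m∣n⇒∣m+n (m∣m*n (n ℕ.* suc (2 ℕ.* n))) (2∣n[n+1] n))
    where
    lem : ∀ n → 2 ℕ.* (n ℕ.* suc (2 ℕ.* n)) ℕ.+ n ℕ.* suc n ≡ n ℕ.* (5 ℕ.* n ℕ.+ 3)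
    lem = ℕSolver.solve-∀
  product-even -[1+ n ] = subst (2 ∣_) (lem n)
    (∣m∣n⇒∣m+n (m∣m*n (suc n ℕ.* suc (2 ℕ.* n))) (2∣n[n+1] n))
    where
    lem : ∀ n → 2 ℕ.* (suc n ℕ.* suc (2 ℕ.* n)) ℕ.+ n ℕ.* suc n ≡ suc n ℕ.* (5 ℕ.* n ℕ.+ 2)
    lem = ℕSolver.solve-∀

  2≤∣5j+3∣ : ∀ j → 2 ℕ.≤ ∣5j+3∣ j
  2≤∣5j+3∣ (+ n)    = ℕ.≤-trans (s≤s (s≤s z≤n)) (ℕ.m≤n+m 3 (5 ℕ.* n))
  2≤∣5j+3∣ -[1+ n ] = ℕ.m≤n+m 2 (5 ℕ.* n)

  exponent-*2 : ∀ j → j[5j+3]/2 j ℕ.* 2 ≡ ∣ j ∣ ℕ.* ∣5j+3∣ j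
  exponent-*2 j rewrite product-≡ j = ℕ.m/n*n≡m (product-even j)

j[5j+3]/2-*2 : ∀ j → + j[5j+3]/2 j ℤ.* + 2 ≡ j ℤ.* (+ 5 ℤ.* j ℤ.+ + 3)
j[5j+3]/2-*2 j = begin
  + j[5j+3]/2 j ℤ.* + 2         ≡⟨ ℤ.pos-* (j[5j+3]/2 j) 2 ⟨
  + (j[5j+3]/2 j ℕ.* 2)         ≡⟨ cong +_ (exponent-*2 j) ⟩
  + (∣ j ∣ ℕ.* ∣5j+3∣ j)        ≡⟨ product-≡ j ⟨
  j ℤ.* (+ 5 ℤ.* j ℤ.+ + 3)     ∎
  where open ≡-Reasoning

∣j∣≤j[5j+3]/2 : ∀ j → ∣ j ∣ ℕ.≤ j[5j+3]/2 j
∣j∣≤j[5j+3]/2 j = ℕ.*-cancelʳ-≤ ∣ j ∣ (j[5j+3]/2 j) 2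
  (subst (∣ j ∣ ℕ.* 2 ℕ.≤_) (sym (exponent-*2 j)) (ℕ.*-monoʳ-≤ ∣ j ∣ (2≤∣5j+3∣ j)))

private
  toℚᵘ-/1 : ∀ z → toℚᵘ (z ℚ./ 1) ℚᵘ.≃ mkℚᵘ z 0
  toℚᵘ-/1 z = ℚ.toℚᵘ-fromℚᵘ (mkℚᵘ z 0)

  cross : ∀ e j → e ℤ.* + 2 ≡ j ℤ.* (+ 5 ℤ.* j ℤ.+ + 3) →
          mkℚᵘ e 0 ℚᵘ.≃ mkℚᵘ (+ 5) 1 ℚᵘ.* (mkℚᵘ j 0 ℚᵘ.* mkℚᵘ j 0)
                        ℚᵘ.+ mkℚᵘ (+ 3) 1 ℚᵘ.* mkℚᵘ j 0
  cross e j eq = *≡* (trans (lem₁ e) (trans (cong (ℤ._* + 2) eq) (lem₂ j)))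
    where
    lem₁ : ∀ e → e ℤ.* + 4 ≡ e ℤ.* + 2 ℤ.* + 2
    lem₁ = ℤSolver.solve-∀
    lem₂ : ∀ j → j ℤ.* (+ 5 ℤ.* j ℤ.+ + 3) ℤ.* + 2 ≡
                 (+ 5 ℤ.* (j ℤ.* j) ℤ.* + 2 ℤ.+ + 3 ℤ.* j ℤ.* + 2) ℤ.* 1ℤ
    lem₂ = ℤSolver.solve-∀

  j[5j+3]/2-≡ : ∀ j → (+ j[5j+3]/2 j) ℚ./ 1 ≡
                      5/2 ℚ.* ((j ℚ./ 1) ℚ.* (j ℚ./ 1)) ℚ.+ 3/2 ℚ.* (j ℚ./ 1)
  j[5j+3]/2-≡ j = ℚ.toℚᵘ-injective (begin
    toℚᵘ (e ℚ./ 1)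
      ≈⟨ toℚᵘ-/1 e ⟩
    mkℚᵘ e 0
      ≈⟨ cross e j (j[5j+3]/2-*2 j) ⟩
    mkℚᵘ (+ 5) 1 ℚᵘ.* (J ℚᵘ.* J) ℚᵘ.+ mkℚᵘ (+ 3) 1 ℚᵘ.* J
      ≈⟨ ℚᵘ.+-cong (ℚᵘ.*-congˡ {mkℚᵘ (+ 5) 1} (ℚᵘ.*-cong (toℚᵘ-/1 j) (toℚᵘ-/1 j)))
                   (ℚᵘ.*-congˡ {mkℚᵘ (+ 3) 1} (toℚᵘ-/1 j)) ⟨
    toℚᵘ 5/2 ℚᵘ.* (toℚᵘ x ℚᵘ.* toℚᵘ x) ℚᵘ.+ toℚᵘ 3/2 ℚᵘ.* toℚᵘ x
      ≈⟨ ℚᵘ.+-cong (ℚᵘ.≃-trans (ℚ.toℚᵘ-homo-* 5/2 (x ℚ.* x))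
                      (ℚᵘ.*-congˡ {toℚᵘ 5/2} (ℚ.toℚᵘ-homo-* x x)))
                   (ℚ.toℚᵘ-homo-* 3/2 x) ⟨
    toℚᵘ (5/2 ℚ.* (x ℚ.* x)) ℚᵘ.+ toℚᵘ (3/2 ℚ.* x)
      ≈⟨ ℚ.toℚᵘ-homo-+ (5/2 ℚ.* (x ℚ.* x)) (3/2 ℚ.* x) ⟨
    toℚᵘ (5/2 ℚ.* (x ℚ.* x) ℚ.+ 3/2 ℚ.* x) ∎)
    where
    open import Relation.Binary.Reasoning.Setoid ℚᵘ.≃-setoid
    e : ℤ
    e = + j[5j+3]/2 j
    x : ℚ
    x = j ℚ./ 1
    J : ℚᵘ.ℚᵘ
    J = mkℚᵘ j 0

exponents : QuadraticExponent 5/2 3/2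
exponents = record
  { exponent   = j[5j+3]/2
  ; exponent-≡ = j[5j+3]/2-≡
  ; bound      = λ n → n
  ; ∣j∣≤bound  = ∣j∣≤j[5j+3]/2
  }

{-# OPTIONS --safe #-}
module Submission where

-- Let e k = k(5k+3)/2 and e′ k = e k + 2k + 1 be the exponents belonging to j = k and
-- j = - k - 1.  Passing from k to k + 1 removes these two terms and flips all signs, so
--   γ k + γ (k+1) = (q^(e k) - q^(e′ k)) / ((1-q)(1-q⁴)(1-q⁵)).
-- The coefficients of 40 / ((1-q)(1-q⁴)(1-q⁵)) are a square plus a periodic function.
-- Hence 40 times the coefficient of q^n on the right, φ k n, telescopes for n ≥ e′ k as
-- W k n + W (k+1) n with W a cubic in k plus a periodic function; that the latter is periodic,
-- hence bounded, is the cancellation on which the proof rests.  So if e J ≤ n < e (J+1), then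
-- 40 γ k n = W k n ± V J n with V J n = φ J n - W J n.  At k = 1 both W k n and V J n have
-- order J², with leading coefficients 5 and at most 4, and for J ≥ 10 this gap absorbs the
-- periodic parts; the finitely many n < e 10 are checked by computation.

open import Defs
open import Algebra.Bundles using (AbelianGroup)
open import Algebra.Properties.Group using (∙-cancelʳ)
open import Data.Bool.Base using (true; false; if_then_else_)
open import Data.Fin.Base using (Fin; toℕ)
open import Data.Fin.Properties using (all?; fromℕ<-cong)
open import Data.Integer.Base as ℤ
  using (ℤ; +_; -[1+_]; 0ℤ; 1ℤ; -1ℤ; ∣_∣; _+_; _*_; _-_; -_; _≤_; _⊖_)
import Data.Integer.Properties as ℤ
open import Data.Integer.Tactic.RingSolver using (solve-∀)
open import Data.List.Base using ([]; _∷_; _++_; map; filter; upTo; applyUpTo)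
open import Data.List.Properties
  using (filter-++; filter-accept; filter-reject; map-++; map-upTo; map-applyUpTo)
open import Data.Nat.Base as ℕ using (ℕ; zero; suc; NonZero; z≤n; s≤s)
open import Data.Nat.DivMod using (_mod_; _divMod_; _%_; m%n<n; [m+kn]%n≡m%n; result)
import Data.Nat.Properties as ℕ
import Data.Nat.Tactic.RingSolver as ℕSolver
open import Data.Product.Base using (_×_; _,_; ∃-syntax; ∃₂)
open import Data.Sum.Base using (_⊎_; inj₁; inj₂)
open import Data.Vec.Base using (Vec; []; _∷_; lookup)
open import Function.Base using (_∘_)
open import Relation.Binary.Definitions using (Tri; tri<; tri≈; tri>)
open import Relation.Binary.PropositionalEquality
  using (_≡_; _≢_; refl; sym; trans; cong; cong₂; subst; module ≡-Reasoning)
open import Relation.Nullary using (¬_; Dec; yes; no)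
open import Relation.Nullary.Decidable using (does; dec-true; dec-false; from-yes)
open import Relation.Unary using (Pred; Decidable)

-- Convolution

-- A coefficient of a product sees only coefficients of degree at most `n`, so agreement up to `n`
-- suffices. This bounded form serves both the vanishing below the lowest degree and the strong
-- induction in `⊛-cancelˡ`.
⊛-cong-≤ : ∀ c f {g h} n → (∀ i → i ℕ.≤ n → g i ≡ c * h i) → (f ⊛ g) n ≡ c * (f ⊛ h) n
⊛-cong-≤ c f {g} {h} zero g≡ch rewrite g≡ch 0 z≤n = lem (f 0) c (h 0)
  where
  lem : ∀ x c y → x * (c * y) + 0ℤ ≡ c * (x * y + 0ℤ)
  lem = solve-∀
⊛-cong-≤ c f {g} {h} (suc n) g≡ch
  rewrite g≡ch (suc n) ℕ.≤-refl
        | ⊛-cong-≤ c (f ∘ suc) {g} {h} n (λ i i≤n → g≡ch i (ℕ.m≤n⇒m≤1+n i≤n)) =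
  lem (f 0) c (h (suc n)) (((f ∘ suc) ⊛ h) n)
  where
  lem : ∀ x c y z → x * (c * y) + c * z ≡ c * (x * y + z)
  lem = solve-∀

⊛-zero : ∀ f {g} n → (∀ i → i ℕ.≤ n → g i ≡ 0ℤ) → (f ⊛ g) n ≡ 0ℤ
⊛-zero f {g} n g≡0 = trans
  (⊛-cong-≤ 0ℤ f {h = g} n (λ i i≤n → trans (g≡0 i i≤n) (sym (ℤ.*-zeroˡ (g i)))))
  (ℤ.*-zeroˡ ((f ⊛ g) n))

⊛-+ : ∀ f g h n → (f ⊛ (λ i → g i + h i)) n ≡ (f ⊛ g) n + (f ⊛ h) n
⊛-+ f g h zero = lem (f 0) (g 0) (h 0)
  where
  lem : ∀ x y z → x * (y + z) + 0ℤ ≡ (x * y + 0ℤ) + (x * z + 0ℤ)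
  lem = solve-∀
⊛-+ f g h (suc n) rewrite ⊛-+ (f ∘ suc) g h n = lem (f 0) (g (suc n)) (h (suc n)) _ _
  where
  lem : ∀ x y z u v → x * (y + z) + (u + v) ≡ (x * y + u) + (x * z + v)
  lem = solve-∀

⊛-- : ∀ f g h n → (f ⊛ (λ i → g i - h i)) n ≡ (f ⊛ g) n - (f ⊛ h) n
⊛-- f g h n = trans (⊛-+ f g (λ i → - h i) n)
  (cong (λ z → (f ⊛ g) n + z) (trans
    (⊛-cong-≤ -1ℤ f n (λ i _ → sym (ℤ.-1*i≡-i (h i)))) (ℤ.-1*i≡-i ((f ⊛ h) n))))

-- With constant term 1, the coefficient of degree `n` of `f ⊛ g` is `g n` plus terms in lower
-- coefficients of `g`, so strong induction on the degree recovers `g n`.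
⊛-cancelˡ : ∀ c f {g h} → f 0 ≡ 1ℤ → (∀ n → (f ⊛ g) n ≡ c * (f ⊛ h) n) →
            ∀ n → g n ≡ c * h n
⊛-cancelˡ c f {g} {h} f0≡1 eq n = below n n ℕ.≤-refl
  where
  below : ∀ m i → i ℕ.≤ m → g i ≡ c * h i
  below m zero _ = trans (lem (g 0)) (trans
    (subst (λ x → x * g 0 + 0ℤ ≡ c * (x * h 0 + 0ℤ)) f0≡1 (eq 0)) (cong (c *_) (sym (lem (h 0)))))
    where
    lem : ∀ x → x ≡ 1ℤ * x + 0ℤ
    lem = solve-∀
  below (suc m) (suc i) (s≤s i≤m) =
    ∙-cancelʳ (AbelianGroup.group ℤ.+-0-abelianGroup) (((f ∘ suc) ⊛ g) i) _ _ (begin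
    g (suc i) + ((f ∘ suc) ⊛ g) i
      ≡⟨ cong (_+ ((f ∘ suc) ⊛ g) i) (sym (ℤ.*-identityˡ (g (suc i)))) ⟩
    1ℤ * g (suc i) + ((f ∘ suc) ⊛ g) i
      ≡⟨ subst (λ x → x * g (suc i) + ((f ∘ suc) ⊛ g) i ≡
                      c * (x * h (suc i) + ((f ∘ suc) ⊛ h) i)) f0≡1 (eq (suc i)) ⟩
    c * (1ℤ * h (suc i) + ((f ∘ suc) ⊛ h) i)
      ≡⟨ lem c (h (suc i)) _ ⟩
    c * h (suc i) + c * ((f ∘ suc) ⊛ h) i
      ≡⟨ cong (λ z → c * h (suc i) + z) (sym (⊛-cong-≤ c (f ∘ suc) i
           (λ j j≤i → below m j (ℕ.≤-trans j≤i i≤m)))) ⟩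
    c * h (suc i) + ((f ∘ suc) ⊛ g) i ∎)
    where
    open ≡-Reasoning
    lem : ∀ c x y → c * (1ℤ * x + y) ≡ c * x + c * y
    lem = solve-∀

-- Multiplication by powers of q.

shift : ℕ → PowerSeries → PowerSeries
shift m f n = if does (m ℕ.≤? n) then f (n ℕ.∸ m) else 0ℤ

shift-+ : ∀ m f n → shift m f (m ℕ.+ n) ≡ f n
shift-+ m f n rewrite dec-true (m ℕ.≤? m ℕ.+ n) (ℕ.m≤m+n m n) = cong f (ℕ.m+n∸m≡n m n)

shift-< : ∀ {m n} f → n ℕ.< m → shift m f n ≡ 0ℤ
shift-< {m} {n} f n<m rewrite dec-false (m ℕ.≤? n) (ℕ.<⇒≱ n<m) = refl

shift-* : ∀ m c f g → (∀ n → g n ≡ c * f n) → ∀ n → c * shift m f n ≡ shift m g n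
shift-* m c f g g≡cf n with does (m ℕ.≤? n)
... | true  = sym (g≡cf _)
... | false = ℤ.*-zeroʳ c

q^-≢ : ∀ {m n} → m ≢ n → (q^ m) n ≡ 0ℤ
q^-≢ {m} {n} m≢n rewrite dec-false (m ℕ.≟ n) m≢n = refl

q^-refl : ∀ m → (q^ m) m ≡ 1ℤ
q^-refl m rewrite dec-true (m ℕ.≟ m) refl = refl

q^-< : ∀ {m n} → n ℕ.< m → (q^ m) n ≡ 0ℤ
q^-< n<m = q^-≢ (ℕ.>⇒≢ n<m)

⊛-q^-< : ∀ f {m n} → n ℕ.< m → (f ⊛ q^ m) n ≡ 0ℤ
⊛-q^-< f {m} {n} n<m = ⊛-zero f n (λ i i≤n → q^-< (ℕ.≤-<-trans i≤n n<m))

⊛-q^-+ : ∀ f m n → (f ⊛ q^ m) (m ℕ.+ n) ≡ f n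
⊛-q^-+ f zero    zero = lem (f 0)
  where
  lem : ∀ x → x * 1ℤ + 0ℤ ≡ x
  lem = solve-∀
⊛-q^-+ f (suc m) zero rewrite ℕ.+-identityʳ m | q^-refl (suc m)
                            | ⊛-q^-< (f ∘ suc) (ℕ.n<1+n m) = lem (f 0)
  where
  lem : ∀ x → x * 1ℤ + 0ℤ ≡ x
  lem = solve-∀
⊛-q^-+ f m (suc n) rewrite ℕ.+-suc m n | ⊛-q^-+ (f ∘ suc) m n
                         | q^-≢ {m} {suc (m ℕ.+ n)} (ℕ.<⇒≢ (s≤s (ℕ.m≤m+n m n))) = lem (f 0) (f (suc n))
  where
  lem : ∀ x y → x * 0ℤ + y ≡ y
  lem = solve-∀

⊛-q^ : ∀ f m n → (f ⊛ q^ m) n ≡ shift m f n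
⊛-q^ f m n with m ℕ.≤? n
... | yes m≤n with k , refl ← ℕ.m≤n⇒∃[o]m+o≡n m≤n =
  trans (⊛-q^-+ f m k) (sym (shift-+ m f k))
... | no m≰n = trans (⊛-q^-< f (ℕ.≰⇒> m≰n)) (sym (shift-< f (ℕ.≰⇒> m≰n)))

⊛-1-q^ : ∀ f m n → (f ⊛ 1-q^ m) (m ℕ.+ n) ≡ f (m ℕ.+ n) - f n
⊛-1-q^ f m n = trans (⊛-- f (q^ 0) (q^ m) (m ℕ.+ n))
  (cong₂ _-_ (⊛-q^-+ f 0 (m ℕ.+ n)) (⊛-q^-+ f m n))

-- The exponents and the theta series

-- The sequence k(5k+3)/2 is given by its differences 5k+4, so that it computes without division.
e : ℕ → ℕ
e zero    = 0
e (suc k) = e k ℕ.+ (5 ℕ.* k ℕ.+ 4)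

e′ : ℕ → ℕ
e′ k = e k ℕ.+ (2 ℕ.* k ℕ.+ 1)

e-*2 : ∀ k → e k ℕ.* 2 ≡ k ℕ.* (5 ℕ.* k ℕ.+ 3)
e-*2 zero    = refl
e-*2 (suc k) = trans (ℕ.*-distribʳ-+ 2 (e k) (5 ℕ.* k ℕ.+ 4))
  (trans (cong (ℕ._+ (5 ℕ.* k ℕ.+ 4) ℕ.* 2) (e-*2 k)) (lem k))
  where
  lem : ∀ k → k ℕ.* (5 ℕ.* k ℕ.+ 3) ℕ.+ (5 ℕ.* k ℕ.+ 4) ℕ.* 2 ≡ suc k ℕ.* (5 ℕ.* suc k ℕ.+ 3)
  lem = ℕSolver.solve-∀

+e-*2 : ∀ k → + e k * + 2 ≡ + k * (+ 5 * + k + + 3)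
+e-*2 k = begin
  + e k * + 2                  ≡⟨ ℤ.pos-* (e k) 2 ⟨
  + (e k ℕ.* 2)                ≡⟨ cong +_ (e-*2 k) ⟩
  + (k ℕ.* (5 ℕ.* k ℕ.+ 3))    ≡⟨ ℤ.pos-* k (5 ℕ.* k ℕ.+ 3) ⟩
  + k * (+ (5 ℕ.* k) + + 3)    ≡⟨ cong (λ x → + k * (x + + 3)) (ℤ.pos-* 5 k) ⟩
  + k * (+ 5 * + k + + 3)      ∎
  where open ≡-Reasoning

exponent-+ : ∀ k → j[5j+3]/2 (+ k) ≡ e k
exponent-+ k = ℤ.+-injective (ℤ.*-cancelʳ-≡ (+ j[5j+3]/2 (+ k)) (+ e k) (+ 2)
  (trans (j[5j+3]/2-*2 (+ k)) (sym (+e-*2 k))))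

exponent-neg : ∀ k → j[5j+3]/2 -[1+ k ] ≡ e′ k
exponent-neg k = ℤ.+-injective (ℤ.*-cancelʳ-≡ (+ j[5j+3]/2 -[1+ k ]) (+ e′ k) (+ 2) (begin
  + j[5j+3]/2 -[1+ k ] * + 2                            ≡⟨ j[5j+3]/2-*2 -[1+ k ] ⟩
  -[1+ k ] * (+ 5 * -[1+ k ] + + 3)                     ≡⟨ lem₁ (+ k) ⟩
  + k * (+ 5 * + k + + 3) + (+ 2 * + k + 1ℤ) * + 2      ≡⟨ cong₂ _+_ (sym (+e-*2 k))
    (cong (λ x → (x + 1ℤ) * + 2) (sym (ℤ.pos-* 2 k))) ⟩
  + e k * + 2 + + (2 ℕ.* k ℕ.+ 1) * + 2                 ≡⟨ ℤ.*-distribʳ-+ (+ 2) (+ e k) (+ (2 ℕ.* k ℕ.+ 1)) ⟨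
  + e′ k * + 2                                          ∎))
  where
  open ≡-Reasoning
  lem₁ : ∀ k → - (1ℤ + k) * (+ 5 * - (1ℤ + k) + + 3) ≡
               k * (+ 5 * k + + 3) + (+ 2 * k + 1ℤ) * + 2
  lem₁ = solve-∀

k≤e : ∀ k → k ℕ.≤ e k
k≤e zero    = z≤n
k≤e (suc k) = subst (ℕ._≤ e (suc k)) (ℕ.+-comm k 1)
  (ℕ.+-mono-≤ (k≤e k) (ℕ.m≤n⇒m≤o+n (5 ℕ.* k) (s≤s z≤n)))

e-mono : ∀ {k l} → k ℕ.≤ l → e k ℕ.≤ e l
e-mono k≤l = e-mono′ (ℕ.≤⇒≤′ k≤l)
  where
  e-mono′ : ∀ {k l} → k ℕ.≤′ l → e k ℕ.≤ e l
  e-mono′ ℕ.≤′-refl           = ℕ.≤-refl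
  e-mono′ (ℕ.≤′-step {l} k≤l) = ℕ.≤-trans (e-mono′ k≤l) (ℕ.m≤m+n (e l) (5 ℕ.* l ℕ.+ 4))

e≤e′ : ∀ k → e k ℕ.≤ e′ k
e≤e′ k = ℕ.m≤m+n (e k) _

-- Alternating sums and the tail of the theta series.

alt : PowerSeries → ℕ → ℤ
alt x zero    = 0ℤ
alt x (suc n) = x 0 - alt (x ∘ suc) n

alt-cong : ∀ {x y} → (∀ i → x i ≡ y i) → ∀ n → alt x n ≡ alt y n
alt-cong x≡y zero    = refl
alt-cong x≡y (suc n) = cong₂ _-_ (x≡y 0) (alt-cong (x≡y ∘ suc) n)

alt-zero : ∀ {x} → (∀ i → x i ≡ 0ℤ) → ∀ n → alt x n ≡ 0ℤ
alt-zero x≡0 zero    = refl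
alt-zero x≡0 (suc n) rewrite x≡0 0 | alt-zero (x≡0 ∘ suc) n = refl

alt-extend : ∀ {x m n} → m ℕ.≤ n → (∀ i → m ℕ.≤ i → x i ≡ 0ℤ) → alt x m ≡ alt x n
alt-extend {n = n} z≤n x≡0 = sym (alt-zero (λ i → x≡0 i z≤n) n)
alt-extend {x} (s≤s m≤n) x≡0 =
  cong (λ z → x 0 - z) (alt-extend m≤n (λ i m≤i → x≡0 (suc i) (s≤s m≤i)))

sum-alternating : ∀ {s x} → (∀ i → s (suc i) ≡ - s i) → ∀ n →
                  sumℤ (applyUpTo (λ i → s i * x i) n) ≡ s 0 * alt x n
sum-alternating {s} s-alt zero = sym (ℤ.*-zeroʳ (s 0))
sum-alternating {s} {x} s-alt (suc n)
  rewrite sum-alternating {s ∘ suc} {x ∘ suc} (s-alt ∘ suc) n | s-alt 0 = lem (s 0) (x 0) _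
  where
  lem : ∀ s x y → s * x + (- s) * y ≡ s * (x - y)
  lem = solve-∀

sum-++ : ∀ xs ys → sumℤ (xs ++ ys) ≡ sumℤ xs + sumℤ ys
sum-++ []       ys = sym (ℤ.+-identityˡ _)
sum-++ (x ∷ xs) ys = trans (cong (λ z → x + z) (sum-++ xs ys)) (sym (ℤ.+-assoc x (sumℤ xs) (sumℤ ys)))

filter-applyUpTo : ∀ {a p} {A : Set a} {P : Pred A p} (P? : Decidable P) (f : ℕ → A) k n →
  (∀ {i} → i ℕ.< k → ¬ P (f i)) → (∀ {i} → k ℕ.≤ i → P (f i)) →
  filter P? (applyUpTo f n) ≡ applyUpTo (f ∘ (k ℕ.+_)) (n ℕ.∸ k)
filter-applyUpTo P? f zero    zero    below above = refl
filter-applyUpTo P? f (suc k) zero    below above = refl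
filter-applyUpTo P? f zero    (suc n) below above = trans
  (filter-accept P? (above z≤n))
  (cong (f 0 ∷_) (filter-applyUpTo P? (f ∘ suc) 0 n (λ ()) (λ _ → above z≤n)))
filter-applyUpTo P? f (suc k) (suc n) below above = trans
  (filter-reject P? (below (s≤s z≤n)))
  (filter-applyUpTo P? (f ∘ suc) k n (below ∘ s≤s) (above ∘ s≤s))

-k-1 : ∀ k → - (+ k) - 1ℤ ≡ -[1+ k ]
-k-1 zero    = refl
-k-1 (suc k) = cong (-[1+_] ∘ suc) (ℕ.+-identityʳ k)

outside-+ : ∀ {k i} → k ℕ.≤ i → Outside k (+ i)
outside-+ k≤i = inj₂ (ℤ.+≤+ k≤i)

¬outside-+ : ∀ {k i} → i ℕ.< k → ¬ Outside k (+ i)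
¬outside-+ {k} i<k (inj₁ h) with () ← subst (+ _ ≤_) (-k-1 k) h
¬outside-+ i<k (inj₂ (ℤ.+≤+ k≤i)) = ℕ.<⇒≱ i<k k≤i

outside-neg : ∀ {k i} → k ℕ.≤ i → Outside k -[1+ i ]
outside-neg {k} k≤i = inj₁ (subst (-[1+ _ ] ≤_) (sym (-k-1 k)) (ℤ.-≤- k≤i))

¬outside-neg : ∀ {k i} → i ℕ.< k → ¬ Outside k -[1+ i ]
¬outside-neg {k} i<k (inj₁ h) with ℤ.-≤- k≤i ← subst (-[1+ _ ] ≤_) (-k-1 k) h = ℕ.<⇒≱ i<k k≤i

[-1]^-suc : ∀ n → -1ℤ ℤ.^ suc n ≡ - (-1ℤ ℤ.^ n)
[-1]^-suc n = ℤ.-1*i≡-i (-1ℤ ℤ.^ n)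

[-1]^-double : ∀ k → -1ℤ ℤ.^ (k ℕ.+ k) ≡ 1ℤ
[-1]^-double zero = refl
[-1]^-double (suc k) rewrite ℕ.+-suc k k | [-1]^-double k = refl

∣-k-i-1+k∣ : ∀ k i → ∣ -[1+ k ℕ.+ i ] + + k ∣ ≡ suc i
∣-k-i-1+k∣ k i = begin
  ∣ k ⊖ suc (k ℕ.+ i) ∣         ≡⟨ ℤ.∣⊖∣-≤ (ℕ.m≤n⇒m≤1+n (ℕ.m≤m+n k i)) ⟩
  suc (k ℕ.+ i) ℕ.∸ k           ≡⟨ cong (ℕ._∸ k) (sym (ℕ.+-suc k i)) ⟩
  k ℕ.+ suc i ℕ.∸ k             ≡⟨ ℕ.m+n∸m≡n k (suc i) ⟩
  suc i                         ∎
  where open ≡-Reasoning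

-- `Outside k` leaves a final segment of each half of the window. The sign is (-1)^(2k+i) = (-1)^i
-- at j = k + i and (-1)^(i+1) at j = - k - 1 - i, hence a difference of two alternating sums.
signedTail : ∀ (x : ℤ → ℤ) k n →
  sumℤ (map (λ j → ([-1]^ (j + + k)) * x j) (filter (outside? k) (window n))) ≡
  alt (λ i → x (+ (k ℕ.+ i))) (suc n ℕ.∸ k) - alt (λ i → x -[1+ k ℕ.+ i ]) (n ℕ.∸ k)
signedTail x k n = begin
  sumℤ (map c (filter (outside? k) (map +_ (upTo (suc n)) ++ map -[1+_] (upTo n))))
    ≡⟨ cong (sumℤ ∘ map c) (trans (filter-++ (outside? k) (map +_ (upTo (suc n))) _) (cong₂ _++_
         (trans (cong (filter (outside? k)) (map-upTo +_ (suc n)))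
                (filter-applyUpTo (outside? k) +_ k (suc n) ¬outside-+ outside-+))
         (trans (cong (filter (outside? k)) (map-upTo -[1+_] n))
                (filter-applyUpTo (outside? k) -[1+_] k n ¬outside-neg outside-neg)))) ⟩
  sumℤ (map c (applyUpTo (λ i → + (k ℕ.+ i)) (suc n ℕ.∸ k) ++
               applyUpTo (λ i → -[1+ k ℕ.+ i ]) (n ℕ.∸ k)))
    ≡⟨ cong sumℤ (trans (map-++ c (applyUpTo (λ i → + (k ℕ.+ i)) (suc n ℕ.∸ k)) _) (cong₂ _++_
         (map-applyUpTo (λ i → + (k ℕ.+ i)) c (suc n ℕ.∸ k))
         (map-applyUpTo (λ i → -[1+ k ℕ.+ i ]) c (n ℕ.∸ k)))) ⟩
  sumℤ (applyUpTo (λ i → s i * x (+ (k ℕ.+ i))) (suc n ℕ.∸ k) ++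
        applyUpTo (λ i → t i * x -[1+ k ℕ.+ i ]) (n ℕ.∸ k))
    ≡⟨ sum-++ (applyUpTo (λ i → s i * x (+ (k ℕ.+ i))) (suc n ℕ.∸ k)) _ ⟩
  sumℤ (applyUpTo (λ i → s i * x (+ (k ℕ.+ i))) (suc n ℕ.∸ k)) +
  sumℤ (applyUpTo (λ i → t i * x -[1+ k ℕ.+ i ]) (n ℕ.∸ k))
    ≡⟨ cong₂ _+_ (sum-alternating {s} s-alt (suc n ℕ.∸ k)) (sum-alternating {t} t-alt (n ℕ.∸ k)) ⟩
  s 0 * alt (λ i → x (+ (k ℕ.+ i))) (suc n ℕ.∸ k) + t 0 * alt (λ i → x -[1+ k ℕ.+ i ]) (n ℕ.∸ k)
    ≡⟨ cong₂ (λ u v → u * alt (λ i → x (+ (k ℕ.+ i))) (suc n ℕ.∸ k) +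
                      v * alt (λ i → x -[1+ k ℕ.+ i ]) (n ℕ.∸ k))
         (trans (cong (λ m → -1ℤ ℤ.^ (m ℕ.+ k)) (ℕ.+-identityʳ k)) ([-1]^-double k))
         (cong (-1ℤ ℤ.^_) (∣-k-i-1+k∣ k 0)) ⟩
  1ℤ * alt (λ i → x (+ (k ℕ.+ i))) (suc n ℕ.∸ k) + -1ℤ * alt (λ i → x -[1+ k ℕ.+ i ]) (n ℕ.∸ k)
    ≡⟨ lem (alt (λ i → x (+ (k ℕ.+ i))) (suc n ℕ.∸ k)) (alt (λ i → x -[1+ k ℕ.+ i ]) (n ℕ.∸ k)) ⟩
  alt (λ i → x (+ (k ℕ.+ i))) (suc n ℕ.∸ k) - alt (λ i → x -[1+ k ℕ.+ i ]) (n ℕ.∸ k) ∎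
  where
  open ≡-Reasoning
  c : ℤ → ℤ
  c j = ([-1]^ (j + + k)) * x j
  lem : ∀ x y → 1ℤ * x + -1ℤ * y ≡ x - y
  lem = solve-∀
  s t : ℕ → ℤ
  s i = [-1]^ (+ (k ℕ.+ i) + + k)
  t i = [-1]^ (-[1+ k ℕ.+ i ] + + k)
  s-alt : ∀ i → s (suc i) ≡ - s i
  s-alt i = trans (cong (λ m → -1ℤ ℤ.^ (m ℕ.+ k)) (ℕ.+-suc k i)) ([-1]^-suc (k ℕ.+ i ℕ.+ k))
  t-alt : ∀ i → t (suc i) ≡ - t i
  t-alt i = trans (cong (-1ℤ ℤ.^_) (∣-k-i-1+k∣ k (suc i)))
    (trans ([-1]^-suc (suc i)) (cong (λ m → - (-1ℤ ℤ.^ m)) (sym (∣-k-i-1+k∣ k i))))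

θ : ℕ → PowerSeries
θ = thetaTail exponents

-- The exponents at index `i` are at least k + i, so terms beyond degree `n` vanish and the
-- truncation may be any `N` above `n`. This freedom lets the tails for k and k + 1 be matched.
θ-alt : ∀ k {n N} → n ℕ.< N →
        θ k n ≡ alt (λ i → (q^ e (k ℕ.+ i)) n) N - alt (λ i → (q^ e′ (k ℕ.+ i)) n) N
θ-alt k {n} {N} n<N = trans (signedTail x k n) (cong₂ _-_ positive negative)
  where
  x : ℤ → ℤ
  x j = (q^ j[5j+3]/2 j) n
  y z : ℕ → ℤ
  y i = (q^ e (k ℕ.+ i)) n
  z i = (q^ e′ (k ℕ.+ i)) n
  k<e′ : ∀ k → k ℕ.< e′ k
  k<e′ k = ℕ.≤-<-trans (k≤e k) (ℕ.m<m+n (e k) (ℕ.m≤n⇒m≤o+n (2 ℕ.* k) (s≤s z≤n)))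
  m∸k≤i⇒m≤k+i : ∀ m {i} → m ℕ.∸ k ℕ.≤ i → m ℕ.≤ k ℕ.+ i
  m∸k≤i⇒m≤k+i m h = ℕ.≤-trans (ℕ.m≤n+m∸n m k) (ℕ.+-monoʳ-≤ k h)
  y-zero : ∀ i → suc n ℕ.∸ k ℕ.≤ i → y i ≡ 0ℤ
  y-zero i h = q^-< (ℕ.≤-trans (m∸k≤i⇒m≤k+i (suc n) h) (k≤e (k ℕ.+ i)))
  z-zero : ∀ i → n ℕ.∸ k ℕ.≤ i → z i ≡ 0ℤ
  z-zero i h = q^-< (ℕ.≤-<-trans (m∸k≤i⇒m≤k+i n h) (k<e′ (k ℕ.+ i)))
  positive : alt (λ i → x (+ (k ℕ.+ i))) (suc n ℕ.∸ k) ≡ alt y N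
  positive = trans
    (alt-cong {λ i → x (+ (k ℕ.+ i))} {y}
      (λ i → cong (λ m → (q^ m) n) (exponent-+ (k ℕ.+ i))) (suc n ℕ.∸ k))
    (alt-extend {y} (ℕ.≤-trans (ℕ.m∸n≤m (suc n) k) n<N) y-zero)
  negative : alt (λ i → x -[1+ k ℕ.+ i ]) (n ℕ.∸ k) ≡ alt z N
  negative = trans
    (alt-cong {λ i → x -[1+ k ℕ.+ i ]} {z}
      (λ i → cong (λ m → (q^ m) n) (exponent-neg (k ℕ.+ i))) (n ℕ.∸ k))
    (alt-extend {z} (ℕ.≤-trans (ℕ.m∸n≤m n k) (ℕ.<⇒≤ n<N)) z-zero)

θ-< : ∀ k {n} → n ℕ.< e k → θ k n ≡ 0ℤ
θ-< k {n} n<ek = trans (θ-alt k (ℕ.n<1+n n)) (cong₂ _-_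
  (alt-zero {λ i → (q^ e (k ℕ.+ i)) n} (λ i → q^-< (n<e i)) (suc n))
  (alt-zero {λ i → (q^ e′ (k ℕ.+ i)) n}
    (λ i → q^-< (ℕ.≤-trans (n<e i) (e≤e′ (k ℕ.+ i)))) (suc n)))
  where
  n<e : ∀ i → n ℕ.< e (k ℕ.+ i)
  n<e i = ℕ.≤-trans n<ek (e-mono (ℕ.m≤m+n k i))

θ-suc : ∀ k n → θ k n + θ (suc k) n ≡ (q^ e k) n - (q^ e′ k) n
θ-suc k n = begin
  θ k n + θ (suc k) n
    -- The truncations are n + 2 for `k` and n + 1 for `suc k`: once the leading terms of the former
    -- are split off, the remaining sums have equal length and cancel.
    ≡⟨ cong₂ _+_ (θ-alt k (ℕ.m<n⇒m<1+n (ℕ.n<1+n n))) (θ-alt (suc k) (ℕ.n<1+n n)) ⟩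
  ((y (k ℕ.+ 0) - Σy) - (z (k ℕ.+ 0) - Σz)) +
  (alt (λ i → y (suc k ℕ.+ i)) (suc n) - alt (λ i → z (suc k ℕ.+ i)) (suc n))
    ≡⟨ cong₂ (λ u v → ((y (k ℕ.+ 0) - Σy) - (z (k ℕ.+ 0) - Σz)) + (u - v))
         (alt-cong {λ i → y (suc k ℕ.+ i)} (λ i → cong y (sym (ℕ.+-suc k i))) (suc n))
         (alt-cong {λ i → z (suc k ℕ.+ i)} (λ i → cong z (sym (ℕ.+-suc k i))) (suc n)) ⟩
  ((y (k ℕ.+ 0) - Σy) - (z (k ℕ.+ 0) - Σz)) + (Σy - Σz)
    ≡⟨ lem (y (k ℕ.+ 0)) Σy (z (k ℕ.+ 0)) Σz ⟩
  y (k ℕ.+ 0) - z (k ℕ.+ 0)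
    ≡⟨ cong (λ m → y m - z m) (ℕ.+-identityʳ k) ⟩
  y k - z k ∎
  where
  open ≡-Reasoning
  y z : ℕ → ℤ
  y i = (q^ e i) n
  z i = (q^ e′ i) n
  Σy Σz : ℤ
  Σy = alt (λ i → y (k ℕ.+ suc i)) (suc n)
  Σz = alt (λ i → z (k ℕ.+ suc i)) (suc n)
  lem : ∀ a x b y → ((a - x) - (b - y)) + (x - y) ≡ a - b
  lem = solve-∀

-- The coefficients of 40 / ((1-q)(1-q⁴)(1-q⁵))

periodic : ∀ {A : Set} {p} .{{_ : NonZero p}} → Vec A p → ℕ → A
periodic {p = p} t n = lookup t (n mod p)

periodic-+ : ∀ {A : Set} {p} .{{_ : NonZero p}} (t : Vec A p) c m →
             periodic t (c ℕ.* p ℕ.+ m) ≡ periodic t m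
periodic-+ {p = p} t c m = cong (lookup t) (fromℕ<-cong _ _
  (trans (cong (_% p) (ℕ.+-comm (c ℕ.* p) m)) ([m+kn]%n≡m%n m c p))
  (m%n<n (c ℕ.* p ℕ.+ m) p) (m%n<n m p))

periodic-≡ : ∀ {A : Set} {p} .{{_ : NonZero p}} (t : Vec A p) c {m n} → n ≡ c ℕ.* p ℕ.+ m →
             periodic t n ≡ periodic t m
periodic-≡ t c {m} n≡cp+m = trans (cong (periodic t) n≡cp+m) (periodic-+ t c m)

-- Reduces a statement about periodic functions to one check for each residue.
residue-induction : ∀ p .{{_ : NonZero p}} {P : ℕ → Set} →
  (∀ (i : Fin p) → P (toℕ i)) → (∀ n → P n → P (p ℕ.+ n)) → ∀ n → P n
residue-induction p {P} base step n with n divMod p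
... | result q r eq = subst P (trans (ℕ.+-comm (q ℕ.* p) (toℕ r)) (sym eq)) (multiple q)
  where
  multiple : ∀ q → P (q ℕ.* p ℕ.+ toℕ r)
  multiple zero    = base r
  multiple (suc q) = subst P (sym (ℕ.+-assoc p (q ℕ.* p) (toℕ r))) (step _ (multiple q))

-- Partial fractions: the simple poles at roots of unity of order dividing 4 and 5 give periodic
-- terms, the triple pole at 1 a quadratic, here centred at -5 because 1 + 4 + 5 = 10. The entries
-- of `βs` sum to 0, so the constant left beside the square sits in `αs`.
αs : Vec ℤ 4
αs = -1ℤ ∷ + 4 ∷ -1ℤ ∷ - + 16 ∷ []

βs : Vec ℤ 5
βs = + 16 ∷ 0ℤ ∷ - + 8 ∷ - + 8 ∷ 0ℤ ∷ []

α β : ℕ → ℤ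
α = periodic αs
β = periodic βs

ρ : PowerSeries
ρ n = (+ n + + 5) * (+ n + + 5) + (α n + β n)

-- The coefficients are those of (1-q)(1-q^4)(1-q^5) = 1 - q - q^4 + q^6 + q^9 - q^10. The square
-- dies because 1 is a triple root, `α` because of the factor 1 - q^4, and `β` because of 1 - q^5.
ρ-recurrence : ∀ n → ρ (10 ℕ.+ n) - ρ (9 ℕ.+ n) - ρ (6 ℕ.+ n) + ρ (4 ℕ.+ n) + ρ (1 ℕ.+ n) - ρ n ≡ 0ℤ
ρ-recurrence n = trans
  (lem (+ n) (α (10 ℕ.+ n)) (β (10 ℕ.+ n)) (α (9 ℕ.+ n)) (β (9 ℕ.+ n)) (α (6 ℕ.+ n)) (β (6 ℕ.+ n))
    (α (4 ℕ.+ n)) (β (4 ℕ.+ n)) (α (1 ℕ.+ n)) (β (1 ℕ.+ n)) (α n) (β n))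
  (cong₂ _+_ α-recurrence β-recurrence)
  where
  lem : ∀ n a10 b10 a9 b9 a6 b6 a4 b4 a1 b1 a0 b0 →
    ((+ 10 + n + + 5) * (+ 10 + n + + 5) + (a10 + b10))
    - ((+ 9 + n + + 5) * (+ 9 + n + + 5) + (a9 + b9))
    - ((+ 6 + n + + 5) * (+ 6 + n + + 5) + (a6 + b6))
    + ((+ 4 + n + + 5) * (+ 4 + n + + 5) + (a4 + b4))
    + ((+ 1 + n + + 5) * (+ 1 + n + + 5) + (a1 + b1))
    - ((n + + 5) * (n + + 5) + (a0 + b0))
    ≡ (a10 - a9 - a6 + a4 + a1 - a0) + (b10 - b9 - b6 + b4 + b1 - b0)
  lem = solve-∀
  cancel₁ : ∀ x y z → x - y - x + z + y - z ≡ 0ℤ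
  cancel₁ = solve-∀
  cancel₂ : ∀ x y z → z - x - y + x + y - z ≡ 0ℤ
  cancel₂ = solve-∀
  α-recurrence : α (10 ℕ.+ n) - α (9 ℕ.+ n) - α (6 ℕ.+ n) + α (4 ℕ.+ n) + α (1 ℕ.+ n) - α n ≡ 0ℤ
  α-recurrence
    rewrite periodic-+ αs 1 (6 ℕ.+ n) | periodic-+ αs 2 (1 ℕ.+ n) | periodic-+ αs 1 n =
    cancel₁ (α (6 ℕ.+ n)) (α (1 ℕ.+ n)) (α n)
  β-recurrence : β (10 ℕ.+ n) - β (9 ℕ.+ n) - β (6 ℕ.+ n) + β (4 ℕ.+ n) + β (1 ℕ.+ n) - β n ≡ 0ℤ
  β-recurrence
    rewrite periodic-+ βs 2 n | periodic-+ βs 1 (4 ℕ.+ n) | periodic-+ βs 1 (1 ℕ.+ n) =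
    cancel₂ (β (4 ℕ.+ n)) (β (1 ℕ.+ n)) (β n)

D : PowerSeries
D = denominator 1 4 5

sum-zero : ∀ {x : ℕ → ℤ} → (∀ i → x i ≡ 0ℤ) → ∀ n → sumℤ (applyUpTo x n) ≡ 0ℤ
sum-zero x≡0 zero    = refl
sum-zero x≡0 (suc n) = cong₂ _+_ (x≡0 0) (sum-zero (x≡0 ∘ suc) n)

D-≥11 : ∀ n → D (11 ℕ.+ n) ≡ 0ℤ
D-≥11 n = begin
  D (11 ℕ.+ n)                                       ≡⟨ ⊛-1-q^ (1-q^ 1 ⊛ 1-q^ 4) 5 (6 ℕ.+ n) ⟩
  (1-q^ 1 ⊛ 1-q^ 4) (11 ℕ.+ n) - (1-q^ 1 ⊛ 1-q^ 4) (6 ℕ.+ n)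
    -- What remains are coefficients of 1 - q in degrees at least 2, which evaluate to 0.
    ≡⟨ cong₂ _-_ (⊛-1-q^ (1-q^ 1) 4 (7 ℕ.+ n)) (⊛-1-q^ (1-q^ 1) 4 (2 ℕ.+ n)) ⟩
  0ℤ                                                 ∎
  where open ≡-Reasoning

D⊛ρ : ∀ n → (D ⊛ ρ) n ≡ + 40 * (q^ 0) n
D⊛ρ 0 = refl
D⊛ρ 1 = refl
D⊛ρ 2 = refl
D⊛ρ 3 = refl
D⊛ρ 4 = refl
D⊛ρ 5 = refl
D⊛ρ 6 = refl
D⊛ρ 7 = refl
D⊛ρ 8 = refl
D⊛ρ 9 = refl
-- From degree 10 on, all eleven coefficients of `D` enter: they unfold to numerals and yield the
-- recurrence, while the tail has only zero factors by `D-≥11`.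
D⊛ρ (suc (suc (suc (suc (suc (suc (suc (suc (suc (suc n)))))))))) = begin
  (D ⊛ ρ) (10 ℕ.+ n)
    ≡⟨ lem (ρ (10 ℕ.+ n)) (ρ (9 ℕ.+ n)) (ρ (8 ℕ.+ n)) (ρ (7 ℕ.+ n)) (ρ (6 ℕ.+ n)) (ρ (5 ℕ.+ n))
         (ρ (4 ℕ.+ n)) (ρ (3 ℕ.+ n)) (ρ (2 ℕ.+ n)) (ρ (1 ℕ.+ n)) (ρ n) tail ⟩
  ρ (10 ℕ.+ n) - ρ (9 ℕ.+ n) - ρ (6 ℕ.+ n) + ρ (4 ℕ.+ n) + ρ (1 ℕ.+ n) - ρ n + tail
    ≡⟨ cong₂ _+_ (ρ-recurrence n) (sum-zero {x} x-zero n) ⟩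
  0ℤ ∎
  where
  open ≡-Reasoning
  x : ℕ → ℤ
  x i = D (11 ℕ.+ i) * ρ (n ℕ.∸ suc i)
  x-zero : ∀ i → x i ≡ 0ℤ
  x-zero i = trans (cong (_* ρ (n ℕ.∸ suc i)) (D-≥11 i)) (ℤ.*-zeroˡ (ρ (n ℕ.∸ suc i)))
  tail : ℤ
  tail = sumℤ (applyUpTo x n)
  lem : ∀ r10 r9 r8 r7 r6 r5 r4 r3 r2 r1 r0 t →
    1ℤ * r10 + (-1ℤ * r9 + (0ℤ * r8 + (0ℤ * r7 + (-1ℤ * r6 + (0ℤ * r5 + (1ℤ * r4 +
      (0ℤ * r3 + (0ℤ * r2 + (1ℤ * r1 + (-1ℤ * r0 + t)))))))))) ≡
    r10 - r9 - r6 + r4 + r1 - r0 + t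
  lem = solve-∀

ρ≡40D⁻¹ : ∀ n → ρ n ≡ + 40 * (D ⁻¹) n
ρ≡40D⁻¹ = ⊛-cancelˡ (+ 40) D refl
  (λ n → trans (D⊛ρ n) (cong (λ z → + 40 * z) (sym (⁻¹-inverseʳ D refl n))))

-- Telescoping

-- The solution of the recursion in `α-telescopes` started from row 0 = 0: each row is the
-- difference of `α`-values minus the row before. Row 7 leads back to row 0; this is the
-- cancellation that keeps `a` bounded.
as : Vec (Vec ℤ 4) 8
as = (0ℤ     ∷ 0ℤ     ∷ 0ℤ     ∷ 0ℤ     ∷ [])
   ∷ (+ 15   ∷ + 5    ∷ - + 5  ∷ - + 15 ∷ [])
   ∷ (- + 20 ∷ 0ℤ     ∷ + 20   ∷ 0ℤ     ∷ [])
   ∷ (+ 5    ∷ + 15   ∷ - + 15 ∷ - + 5  ∷ [])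
   ∷ (0ℤ     ∷ 0ℤ     ∷ 0ℤ     ∷ 0ℤ     ∷ [])
   ∷ (- + 5  ∷ - + 15 ∷ + 15   ∷ + 5    ∷ [])
   ∷ (+ 20   ∷ 0ℤ     ∷ - + 20 ∷ 0ℤ     ∷ [])
   ∷ (- + 15 ∷ - + 5  ∷ + 5    ∷ + 15   ∷ [])
   ∷ []

-- The 5-periodic solution of b n + b (n+1) = β n; as 5 is odd, there is only one.
bs : Vec ℤ 5
bs = + 8 ∷ + 8 ∷ - + 8 ∷ 0ℤ ∷ - + 8 ∷ []

a : ℕ → ℕ → ℤ
a k = periodic (periodic as k)

b : ℕ → ℤ
b = periodic bs

-- Both sides have period 4 in `m` and period 8 in `k`, which leaves 32 cases to evaluate.
α-telescopes : ∀ k m → α (2 ℕ.* k ℕ.+ 1 ℕ.+ m) - α m ≡ a k (e′ k ℕ.+ m) + a (suc k) (e′ k ℕ.+ m)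
α-telescopes = residue-induction 8 {λ k → ∀ m → P k m}
  (λ i → residue-induction 4 {P (toℕ i)} (check i) (step₄ (toℕ i)))
  (λ k ih m → step₈ k m (ih m))
  where
  P : ℕ → ℕ → Set
  P k m = α (2 ℕ.* k ℕ.+ 1 ℕ.+ m) - α m ≡ a k (e′ k ℕ.+ m) + a (suc k) (e′ k ℕ.+ m)
  P? : ∀ k m → Dec (P k m)
  P? k m = α (2 ℕ.* k ℕ.+ 1 ℕ.+ m) - α m ℤ.≟ a k (e′ k ℕ.+ m) + a (suc k) (e′ k ℕ.+ m)
  check : ∀ (i : Fin 8) (j : Fin 4) → P (toℕ i) (toℕ j)
  check = from-yes (all? λ (i : Fin 8) → all? λ (j : Fin 4) → P? (toℕ i) (toℕ j))
  step₄ : ∀ k m → P k m → P k (4 ℕ.+ m)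
  step₄ k m ih = begin
    α (2 ℕ.* k ℕ.+ 1 ℕ.+ (4 ℕ.+ m)) - α (4 ℕ.+ m)
      ≡⟨ cong₂ _-_ (periodic-≡ αs 1 (lem (2 ℕ.* k ℕ.+ 1) m)) (periodic-+ αs 1 m) ⟩
    α (2 ℕ.* k ℕ.+ 1 ℕ.+ m) - α m
      ≡⟨ ih ⟩
    a k (e′ k ℕ.+ m) + a (suc k) (e′ k ℕ.+ m)
      ≡⟨ cong₂ _+_ (sym (periodic-≡ (periodic as k) 1 (lem (e′ k) m)))
                   (sym (periodic-≡ (periodic as (suc k)) 1 (lem (e′ k) m))) ⟩
    a k (e′ k ℕ.+ (4 ℕ.+ m)) + a (suc k) (e′ k ℕ.+ (4 ℕ.+ m)) ∎
    where
    open ≡-Reasoning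
    lem : ∀ x m → x ℕ.+ (4 ℕ.+ m) ≡ 4 ℕ.+ (x ℕ.+ m)
    lem = ℕSolver.solve-∀
  step₈ : ∀ k m → P k m → P (8 ℕ.+ k) m
  step₈ k m ih = begin
    α (2 ℕ.* (8 ℕ.+ k) ℕ.+ 1 ℕ.+ m) - α m
      ≡⟨ cong (_- α m) (periodic-≡ αs 4 (lem₁ k m)) ⟩
    α (2 ℕ.* k ℕ.+ 1 ℕ.+ m) - α m
      ≡⟨ ih ⟩
    a k (e′ k ℕ.+ m) + a (suc k) (e′ k ℕ.+ m)
      ≡⟨ cong₂ _+_ (shifted k) (shifted (suc k)) ⟩
    a (8 ℕ.+ k) (e′ (8 ℕ.+ k) ℕ.+ m) + a (8 ℕ.+ suc k) (e′ (8 ℕ.+ k) ℕ.+ m) ∎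
    where
    open ≡-Reasoning
    lem₁ : ∀ k m → 2 ℕ.* (8 ℕ.+ k) ℕ.+ 1 ℕ.+ m ≡ 16 ℕ.+ (2 ℕ.* k ℕ.+ 1 ℕ.+ m)
    lem₁ = ℕSolver.solve-∀
    lem₂ : ∀ x k m →
      x ℕ.+ (5 ℕ.* k ℕ.+ 4) ℕ.+ (5 ℕ.* (1 ℕ.+ k) ℕ.+ 4) ℕ.+ (5 ℕ.* (2 ℕ.+ k) ℕ.+ 4)
        ℕ.+ (5 ℕ.* (3 ℕ.+ k) ℕ.+ 4) ℕ.+ (5 ℕ.* (4 ℕ.+ k) ℕ.+ 4) ℕ.+ (5 ℕ.* (5 ℕ.+ k) ℕ.+ 4)
        ℕ.+ (5 ℕ.* (6 ℕ.+ k) ℕ.+ 4) ℕ.+ (5 ℕ.* (7 ℕ.+ k) ℕ.+ 4)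
        ℕ.+ (2 ℕ.* (8 ℕ.+ k) ℕ.+ 1) ℕ.+ m ≡
      (10 ℕ.* k ℕ.+ 47) ℕ.* 4 ℕ.+ (x ℕ.+ (2 ℕ.* k ℕ.+ 1) ℕ.+ m)
    lem₂ = ℕSolver.solve-∀
    shifted : ∀ j → a j (e′ k ℕ.+ m) ≡ a (8 ℕ.+ j) (e′ (8 ℕ.+ k) ℕ.+ m)
    shifted j = sym (trans (cong (λ t → periodic t (e′ (8 ℕ.+ k) ℕ.+ m)) (periodic-+ as 1 j))
      -- Raising `k` by 8 raises `e′ k` by 40k + 188 = 4(10k + 47), so the column modulo 4 is
      -- unchanged.
      (periodic-≡ (periodic as j) (10 ℕ.* k ℕ.+ 47) (lem₂ (e k) k m)))

β≡b+b : ∀ n → β n ≡ b n + b (suc n)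
β≡b+b = residue-induction 5 (from-yes (all? λ i → β (toℕ {5} i) ℤ.≟ b (toℕ i) + b (suc (toℕ i))))
  (λ n ih → trans (periodic-+ βs 1 n) (trans ih
    (cong₂ _+_ (sym (periodic-+ bs 1 n)) (sym (periodic-+ bs 1 (suc n))))))

5∣e+k : ∀ k → ∃[ c ] e k ℕ.+ k ≡ c ℕ.* 5
5∣e+k zero = 0 , refl
5∣e+k (suc k) with c , eq ← 5∣e+k k =
  c ℕ.+ suc k , trans (lem₁ (e k) k) (trans (cong (ℕ._+ suc k ℕ.* 5) eq) (lem₂ c k))
  where
  lem₁ : ∀ x k → x ℕ.+ (5 ℕ.* k ℕ.+ 4) ℕ.+ suc k ≡ x ℕ.+ k ℕ.+ suc k ℕ.* 5
  lem₁ = ℕSolver.solve-∀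
  lem₂ : ∀ c k → c ℕ.* 5 ℕ.+ suc k ℕ.* 5 ≡ (c ℕ.+ suc k) ℕ.* 5
  lem₂ = ℕSolver.solve-∀

-- Since e k ≡ - k (mod 5), the arguments of β telescope to n + k and n - k ≡ n + 4 k.
β-telescopes : ∀ k m → let n = e′ k ℕ.+ m in
  β (2 ℕ.* k ℕ.+ 1 ℕ.+ m) - β m ≡
  (b (n ℕ.+ k) - b (n ℕ.+ 4 ℕ.* k)) + (b (n ℕ.+ suc k) - b (n ℕ.+ 4 ℕ.* suc k))
β-telescopes k m with c , eq ← 5∣e+k k = begin
  β M - β m
    ≡⟨ cong₂ _-_ (β≡b+b M) (β≡b+b m) ⟩
  (b M + b (suc M)) - (b m + b (suc m))
    -- Pairing M with m + 1 and M + 1 with m is what works: modulo 5 these are n + k and n + 4k,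
    -- then the same expressions with k + 1 for k.
    ≡⟨ lem (b M) (b (suc M)) (b m) (b (suc m)) ⟩
  (b M - b (suc m)) + (b (suc M) - b m)
    ≡⟨ cong₂ _+_
         (cong₂ _-_ (sym (periodic-≡ bs c (via (lem₁ (e k) k m))))
                    (sym (periodic-≡ bs (c ℕ.+ k) (trans (via (lem₂ (e k) k m)) (lem₅ c k (suc m))))))
         (cong₂ _-_ (sym (periodic-≡ bs c (via (lem₃ (e k) k m))))
                    (sym (periodic-≡ bs (c ℕ.+ suc k) (trans (via (lem₄ (e k) k m)) (lem₅ c (suc k) m))))) ⟩
  (b (n ℕ.+ k) - b (n ℕ.+ 4 ℕ.* k)) + (b (n ℕ.+ suc k) - b (n ℕ.+ 4 ℕ.* suc k)) ∎
  where
  open ≡-Reasoning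
  n M : ℕ
  n = e′ k ℕ.+ m
  M = 2 ℕ.* k ℕ.+ 1 ℕ.+ m
  lem : ∀ x y z w → (x + y) - (z + w) ≡ (x - w) + (y - z)
  lem = solve-∀
  via : ∀ {x y} → x ≡ e k ℕ.+ k ℕ.+ y → x ≡ c ℕ.* 5 ℕ.+ y
  via {y = y} h = trans h (cong (ℕ._+ y) eq)
  lem₁ : ∀ x k m → x ℕ.+ (2 ℕ.* k ℕ.+ 1) ℕ.+ m ℕ.+ k ≡ x ℕ.+ k ℕ.+ (2 ℕ.* k ℕ.+ 1 ℕ.+ m)
  lem₁ = ℕSolver.solve-∀
  lem₂ : ∀ x k m → x ℕ.+ (2 ℕ.* k ℕ.+ 1) ℕ.+ m ℕ.+ 4 ℕ.* k ≡ x ℕ.+ k ℕ.+ (k ℕ.* 5 ℕ.+ suc m)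
  lem₂ = ℕSolver.solve-∀
  lem₃ : ∀ x k m → x ℕ.+ (2 ℕ.* k ℕ.+ 1) ℕ.+ m ℕ.+ suc k ≡ x ℕ.+ k ℕ.+ suc (2 ℕ.* k ℕ.+ 1 ℕ.+ m)
  lem₃ = ℕSolver.solve-∀
  lem₄ : ∀ x k m → x ℕ.+ (2 ℕ.* k ℕ.+ 1) ℕ.+ m ℕ.+ 4 ℕ.* suc k ≡ x ℕ.+ k ℕ.+ (suc k ℕ.* 5 ℕ.+ m)
  lem₄ = ℕSolver.solve-∀
  lem₅ : ∀ c k m → c ℕ.* 5 ℕ.+ (k ℕ.* 5 ℕ.+ m) ≡ (c ℕ.+ k) ℕ.* 5 ℕ.+ m
  lem₅ = ℕSolver.solve-∀

-- The polynomial part of `φ k n` is (n - e k + 5)^2 - (n - e′ k + 5)^2 = (2k+1)(2n + 9 - 5k^2 -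
-- 5k). Since k + (k+1) and k^3 + (k+1)^3 both have the factor 2k+1, a combination of k and k^3
-- telescopes to it.
w W : ℕ → ℕ → ℤ
w k n = a k n + (b (n ℕ.+ k) - b (n ℕ.+ 4 ℕ.* k))
W k n = (+ n * + 2 + + 14) * + k - + 5 * (+ k * + k * + k) + w k n

φ : ℕ → PowerSeries
φ k n = shift (e k) ρ n - shift (e′ k) ρ n

φ-telescopes : ∀ k m → φ k (e′ k ℕ.+ m) ≡ W k (e′ k ℕ.+ m) + W (suc k) (e′ k ℕ.+ m)
φ-telescopes k m = begin
  shift (e k) ρ n - shift (e′ k) ρ n
    ≡⟨ cong₂ _-_ (trans (cong (shift (e k) ρ) (ℕ.+-assoc (e k) (2 ℕ.* k ℕ.+ 1) m)) (shift-+ (e k) ρ M))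
                 (shift-+ (e′ k) ρ m) ⟩
  ρ M - ρ m
    ≡⟨ cong (λ x → ((x + + 1 + + m + + 5) * (x + + 1 + + m + + 5) + (α M + β M)) - ρ m) (ℤ.pos-* 2 k) ⟩
  ((+ 2 * + k + + 1 + + m + + 5) * (+ 2 * + k + + 1 + + m + + 5) + (α M + β M)) - ρ m
    ≡⟨ lem₁ (+ k) (+ m) (α M) (β M) (α m) (β m) ⟩
  ((N + + 14) * + k - + 5 * (+ k * + k * + k)
    + ((N + + 14) * + suc k - + 5 * (+ suc k * + suc k * + suc k)))
    + ((α M - α m) + (β M - β m))
    ≡⟨ cong₂ (λ x y → (((x + + 14) * + k - + 5 * (+ k * + k * + k)
         + ((x + + 14) * + suc k - + 5 * (+ suc k * + suc k * + suc k)))) + y)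
         (sym n*2) (cong₂ _+_ (α-telescopes k m) (β-telescopes k m)) ⟩
  ((+ n * + 2 + + 14) * + k - + 5 * (+ k * + k * + k)
    + ((+ n * + 2 + + 14) * + suc k - + 5 * (+ suc k * + suc k * + suc k)))
    + ((a k n + a (suc k) n)
       + ((b (n ℕ.+ k) - b (n ℕ.+ 4 ℕ.* k)) + (b (n ℕ.+ suc k) - b (n ℕ.+ 4 ℕ.* suc k))))
    ≡⟨ lem₂ ((+ n * + 2 + + 14) * + k - + 5 * (+ k * + k * + k))
            ((+ n * + 2 + + 14) * + suc k - + 5 * (+ suc k * + suc k * + suc k))
            (a k n) (a (suc k) n) (b (n ℕ.+ k) - b (n ℕ.+ 4 ℕ.* k))
            (b (n ℕ.+ suc k) - b (n ℕ.+ 4 ℕ.* suc k)) ⟩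
  W k n + W (suc k) n ∎
  where
  open ≡-Reasoning
  n M : ℕ
  n = e′ k ℕ.+ m
  M = 2 ℕ.* k ℕ.+ 1 ℕ.+ m
  -- This is 2n with `e k` eliminated; doubling avoids the half in k(5k+3)/2.
  N : ℤ
  N = + k * (+ 5 * + k + + 3) + (+ 2 * + k + + 1) * + 2 + + m * + 2
  n*2 : + n * + 2 ≡ N
  n*2 = begin
    (+ e k + + (2 ℕ.* k ℕ.+ 1) + + m) * + 2
      ≡⟨ cong (λ x → (+ e k + (x + + 1) + + m) * + 2) (ℤ.pos-* 2 k) ⟩
    (+ e k + (+ 2 * + k + + 1) + + m) * + 2
      ≡⟨ lem (+ e k) (+ 2 * + k + + 1) (+ m) ⟩
    + e k * + 2 + (+ 2 * + k + + 1) * + 2 + + m * + 2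
      ≡⟨ cong (λ x → x + (+ 2 * + k + + 1) * + 2 + + m * + 2) (+e-*2 k) ⟩
    N ∎
    where
    lem : ∀ x y z → (x + y + z) * + 2 ≡ x * + 2 + y * + 2 + z * + 2
    lem = solve-∀
  lem₁ : ∀ k m αM βM αm βm →
    ((+ 2 * k + + 1 + m + + 5) * (+ 2 * k + + 1 + m + + 5) + (αM + βM))
      - ((m + + 5) * (m + + 5) + (αm + βm)) ≡
    ((k * (+ 5 * k + + 3) + (+ 2 * k + + 1) * + 2 + m * + 2 + + 14) * k - + 5 * (k * k * k)
      + ((k * (+ 5 * k + + 3) + (+ 2 * k + + 1) * + 2 + m * + 2 + + 14) * (+ 1 + k)
         - + 5 * ((+ 1 + k) * (+ 1 + k) * (+ 1 + k))))
      + ((αM - αm) + (βM - βm))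
  lem₁ = solve-∀
  lem₂ : ∀ x y a a′ b b′ → (x + y) + ((a + a′) + (b + b′)) ≡ (x + (a + b)) + (y + (a′ + b′))
  lem₂ = solve-∀

-- The recurrence for γ and the check of small degrees.

Γ : ℕ → PowerSeries
Γ k n = + 40 * γ 1 4 5 5/2 3/2 exponents k n

Γ-< : ∀ k {n} → n ℕ.< e k → Γ k n ≡ 0ℤ
Γ-< k {n} n<ek = trans
  (cong (λ z → + 40 * z) (⊛-zero (D ⁻¹) {θ k} n (λ i i≤n → θ-< k (ℕ.≤-<-trans i≤n n<ek))))
  (ℤ.*-zeroʳ (+ 40))

Γ-suc : ∀ k n → Γ k n + Γ (suc k) n ≡ φ k n
Γ-suc k n = begin
  + 40 * (D ⁻¹ ⊛ θ k) n + + 40 * (D ⁻¹ ⊛ θ (suc k)) n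
    ≡⟨ ℤ.*-distribˡ-+ (+ 40) ((D ⁻¹ ⊛ θ k) n) ((D ⁻¹ ⊛ θ (suc k)) n) ⟨
  + 40 * ((D ⁻¹ ⊛ θ k) n + (D ⁻¹ ⊛ θ (suc k)) n)
    ≡⟨ cong (λ z → + 40 * z) (begin
         (D ⁻¹ ⊛ θ k) n + (D ⁻¹ ⊛ θ (suc k)) n
           ≡⟨ ⊛-+ (D ⁻¹) (θ k) (θ (suc k)) n ⟨
         (D ⁻¹ ⊛ (λ i → θ k i + θ (suc k) i)) n
           ≡⟨ ⊛-cong-≤ 1ℤ (D ⁻¹) {λ i → θ k i + θ (suc k) i} {λ i → (q^ e k) i - (q^ e′ k) i} n
                (λ i _ → trans (θ-suc k i) (sym (ℤ.*-identityˡ ((q^ e k) i - (q^ e′ k) i)))) ⟩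
         1ℤ * (D ⁻¹ ⊛ (λ i → (q^ e k) i - (q^ e′ k) i)) n
           ≡⟨ ℤ.*-identityˡ ((D ⁻¹ ⊛ (λ i → (q^ e k) i - (q^ e′ k) i)) n) ⟩
         (D ⁻¹ ⊛ (λ i → (q^ e k) i - (q^ e′ k) i)) n
           ≡⟨ ⊛-- (D ⁻¹) (q^ e k) (q^ e′ k) n ⟩
         (D ⁻¹ ⊛ q^ e k) n - (D ⁻¹ ⊛ q^ e′ k) n
           ≡⟨ cong₂ _-_ (⊛-q^ (D ⁻¹) (e k) n) (⊛-q^ (D ⁻¹) (e′ k) n) ⟩
         shift (e k) (D ⁻¹) n - shift (e′ k) (D ⁻¹) n ∎) ⟩
  + 40 * (shift (e k) (D ⁻¹) n - shift (e′ k) (D ⁻¹) n)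
    ≡⟨ lem (+ 40) (shift (e k) (D ⁻¹) n) (shift (e′ k) (D ⁻¹) n) ⟩
  + 40 * shift (e k) (D ⁻¹) n - + 40 * shift (e′ k) (D ⁻¹) n
    ≡⟨ cong₂ _-_ (shift-* (e k) (+ 40) (D ⁻¹) ρ ρ≡40D⁻¹ n) (shift-* (e′ k) (+ 40) (D ⁻¹) ρ ρ≡40D⁻¹ n) ⟩
  φ k n ∎
  where
  open ≡-Reasoning
  lem : ∀ c x y → c * (x - y) ≡ c * x - c * y
  lem = solve-∀

Γ≡φ-Γ : ∀ k n → Γ k n ≡ φ k n - Γ (suc k) n
Γ≡φ-Γ k n = trans (lem (Γ k n) (Γ (suc k) n)) (cong (_- Γ (suc k) n) (Γ-suc k n))
  where
  lem : ∀ x y → x ≡ x + y - y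
  lem = solve-∀

-- The recurrence unrolled `i` times. It rests on the closed form `ρ` instead of the inverse series,
-- so it can be evaluated quickly.
alternating-φ : ℕ → ℕ → ℕ → ℤ
alternating-φ zero    k n = 0ℤ
alternating-φ (suc i) k n = φ k n - alternating-φ i (suc k) n

Γ≡alternating-φ : ∀ i k {n} → n ℕ.< e (k ℕ.+ i) → Γ k n ≡ alternating-φ i k n
Γ≡alternating-φ zero    k {n} n<e = Γ-< k (subst (λ j → n ℕ.< e j) (ℕ.+-identityʳ k) n<e)
Γ≡alternating-φ (suc i) k {n} n<e = trans (Γ≡φ-Γ k n)
  (cong (λ z → φ k n - z) (Γ≡alternating-φ i (suc k) (subst (λ j → n ℕ.< e j) (ℕ.+-suc k i) n<e)))

-- The sum runs over the indices k + 1 to 9, as index 10 contributes nothing below degree e 10 =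
-- 265.
small-check : ∀ {k} → k ℕ.< 9 → ∀ {n} → n ℕ.< e 10 → 0ℤ ≤ alternating-φ (9 ℕ.∸ k) (suc k) n
small-check = from-yes (ℕ.allUpTo? (λ k → ℕ.allUpTo? (λ n →
  0ℤ ℤ.≤? alternating-φ (9 ℕ.∸ k) (suc k) n) (e 10)) 9)

Γ≥0-small : ∀ k {n} → n ℕ.< e 10 → 0ℤ ≤ Γ (suc k) n
Γ≥0-small k {n} n<e10 with k ℕ.<? 9
... | yes k<9 = subst (0ℤ ≤_)
  (sym (Γ≡alternating-φ (9 ℕ.∸ k) (suc k)
    (subst (λ j → n ℕ.< e (suc j)) (sym (ℕ.m+[n∸m]≡n (ℕ.<⇒≤ k<9))) n<e10)))
  (small-check k<9 n<e10)
... | no k≮9 = ℤ.≤-reflexive (sym (Γ-< (suc k) (ℕ.≤-trans n<e10 (e-mono (s≤s (ℕ.≮⇒≥ k≮9))))))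

-- Bounds

∣α+β∣≤24 : ∀ n → ∣ α n + β n ∣ ℕ.≤ 24
∣α+β∣≤24 = residue-induction 20 {λ n → ∣ α n + β n ∣ ℕ.≤ 24}
  (from-yes (all? λ (i : Fin 20) → ∣ α (toℕ i) + β (toℕ i) ∣ ℕ.≤? 24))
  (λ n → subst (λ z → ∣ z ∣ ℕ.≤ 24) (sym (cong₂ _+_ (periodic-+ αs 5 n) (periodic-+ βs 4 n))))

∣w∣≤36 : ∀ k n → ∣ w k n ∣ ℕ.≤ 36
∣w∣≤36 k n = ℕ.≤-trans (ℤ.∣i+j∣≤∣i∣+∣j∣ (a k n) (b (n ℕ.+ k) - b (n ℕ.+ 4 ℕ.* k))) (ℕ.+-mono-≤
  (from-yes (all? λ i → all? λ j → ∣ lookup (lookup as i) j ∣ ℕ.≤? 20) (k mod 8) (n mod 4))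
  (ℕ.≤-trans (ℤ.∣i-j∣≤∣i∣+∣j∣ (b (n ℕ.+ k)) (b (n ℕ.+ 4 ℕ.* k)))
    (ℕ.+-mono-≤ (∣b∣≤8 (n ℕ.+ k)) (∣b∣≤8 (n ℕ.+ 4 ℕ.* k)))))
  where
  ∣b∣≤8 : ∀ n → ∣ b n ∣ ℕ.≤ 8
  ∣b∣≤8 n = from-yes (all? λ i → ∣ lookup bs i ∣ ℕ.≤? 8) (n mod 5)

∣i∣≤c⇒0≤c+i : ∀ {i c} → ∣ i ∣ ℕ.≤ c → 0ℤ ≤ + c + i
∣i∣≤c⇒0≤c+i {+ n}       _ = ℤ.+≤+ z≤n
∣i∣≤c⇒0≤c+i { -[1+ n ]} h = subst (0ℤ ≤_) (sym (ℤ.⊖-≥ h)) (ℤ.+≤+ z≤n)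

∣i∣≤c⇒0≤c-i : ∀ {i c} → ∣ i ∣ ℕ.≤ c → 0ℤ ≤ + c - i
∣i∣≤c⇒0≤c-i {i} h = ∣i∣≤c⇒0≤c+i { - i} (subst (ℕ._≤ _) (sym (ℤ.∣-i∣≡∣i∣ i)) h)

infixl 6 _⊕_
infixl 7 _⊗_

_⊕_ : ∀ {x y} → 0ℤ ≤ x → 0ℤ ≤ y → 0ℤ ≤ x + y
_⊕_ = ℤ.+-mono-≤

_⊗_ : ∀ {x y} → 0ℤ ≤ x → 0ℤ ≤ y → 0ℤ ≤ x * y
_⊗_ {+ m} {+ n} _ _ = subst (0ℤ ≤_) (ℤ.pos-* m n) (ℤ.+≤+ z≤n)

pos : ∀ n → 0ℤ ≤ + n
pos n = ℤ.+≤+ z≤n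

square≥0 : ∀ x → 0ℤ ≤ x * x
square≥0 (+ n)    = pos n ⊗ pos n
square≥0 -[1+ n ] = ℤ.+≤+ z≤n

-- Polynomial inequalities are proved by certificates: an expression assembled from nonnegative
-- terms by `⊕` and `⊗`, which the ring solver equates with the target.
0≤-by : ∀ {x y} → 0ℤ ≤ x → x ≡ y → 0ℤ ≤ y
0≤-by h refl = h

-- The polynomial part of W k n, with x = 2 n.
P : ℤ → ℤ → ℤ
P k x = (x + + 14) * k - + 5 * (k * k * k)

-- 2 n for n = e J + t
2n : ℤ → ℤ → ℤ
2n J t = J * (+ 5 * J + + 3) + t * + 2

n*2≡2n : ∀ J t → + (e J ℕ.+ t) * + 2 ≡ 2n (+ J) (+ t)
n*2≡2n J t = trans (ℤ.*-distribʳ-+ (+ 2) (+ e J) (+ t)) (cong (λ x → x + + t * + 2) (+e-*2 J))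

W≡P+w : ∀ k J t → let n = e J ℕ.+ t in W k n ≡ P (+ k) (2n (+ J) (+ t)) + w k n
W≡P+w k J t = cong (λ x → P (+ k) x + w k (e J ℕ.+ t)) (n*2≡2n J t)

-- For k = 1 the difference is 9. For larger k the surplus (k-1) 2n outweighs 5k^3, because 2n is at
-- least 5J^2 + 3J and J exceeds k.
P-lower : ∀ x y t → let k = suc x; J = suc (k ℕ.+ y) in
  0ℤ ≤ P (+ k) (2n (+ J) (+ t)) - 2n (+ J) (+ t)
P-lower x y t = 0≤-by
  (pos x ⊗ (pos 3 ⊗ pos J ⊕ pos 2 ⊗ pos t) ⊕ (pos 5 ⊗ pos x ⊗ pos x ⊕ pos 19 ⊗ pos x ⊕ pos 9)
    ⊕ pos 10 ⊗ pos y ⊗ (pos x ⊗ pos x ⊕ pos 2 ⊗ pos x) ⊕ pos 5 ⊗ pos x ⊗ pos y ⊗ pos y)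
  (lem (+ x) (+ y) (+ t))
  where
  J : ℕ
  J = suc (suc x ℕ.+ y)
  lem : ∀ x y t → let k = + 1 + x; J = + 1 + (+ 1 + x + y) in
    x * (+ 3 * J + + 2 * t) + (+ 5 * x * x + + 19 * x + + 9)
      + + 10 * y * (x * x + + 2 * x) + + 5 * x * y * y ≡
    (J * (+ 5 * J + + 3) + t * + 2 + + 14) * k - + 5 * (k * k * k) - (J * (+ 5 * J + + 3) + t * + 2)
  lem = solve-∀

-- The defect at the last index J, where `Γ (suc J) n` vanishes and the alternating sum ends with
-- `φ J n`.
V : ℕ → ℕ → ℤ
V J n = φ J n - W J n

-- The margin 96 = 36 + 60 absorbs the periodic parts of W k n and V J n.
Dominated : ℤ → ℤ → ℤ → Set
Dominated J t U = 0ℤ ≤ 2n J t - + 96 + U × 0ℤ ≤ 2n J t - + 96 - U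

module _ {J i : ℕ} (J≡10+i : J ≡ 10 ℕ.+ i) (t : ℕ) where
  private
    n : ℕ
    n = e J ℕ.+ t

  -- Below `e′ J` the second shift in `φ` is 0, so `φ J n` is `ρ t`. The periodic parts are at most
  -- 24 from `ρ` and 36 from `w`.
  V-bound-< : t ℕ.< 2 ℕ.* J ℕ.+ 1 →
    ∃₂ λ U ε → V J n ≡ U + ε × ∣ ε ∣ ℕ.≤ 60 × Dominated (+ J) (+ t) U
  V-bound-< t<2J+1
    with s , t+s≡2J ← ℕ.m≤n⇒∃[o]m+o≡n (ℕ.s≤s⁻¹ (subst (suc t ℕ.≤_) (ℕ.+-comm (2 ℕ.* J) 1) t<2J+1)) =
    U (+ J) , (α t + β t) - w J n , V≡U+ε , ε-bound ,
    subst (λ j → Dominated j (+ t) (U j)) (sym +J)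
      -- Completing the square in t leaves J^2 + J - 107, which is 3 at J = 10 and negative at J =
      -- 9: this fixes the threshold 10.
      ( 0≤-by (square≥0 (+ t - (+ 10 + + i) + + 6) ⊕ (pos i ⊗ pos i ⊕ pos 21 ⊗ pos i ⊕ pos 3))
          (lower (+ i) (+ t))
      , 0≤-by (pos t ⊗ pos s ⊕ pos 8 ⊗ pos s ⊕ (pos 8 ⊗ pos i ⊗ pos i ⊕ pos 161 ⊗ pos i ⊕ pos 689))
          (trans (cong (λ x → + t * x + + 8 * x + (+ 8 * + i * + i + + 161 * + i + + 689)) s≡2J-t)
                 (upper (+ i) (+ t))))
    where
    +J : + J ≡ + 10 + + i
    +J = cong +_ J≡10+i
    U : ℤ → ℤ
    U j = (+ t + + 5) * (+ t + + 5) - P j (2n j (+ t))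
    s≡2J-t : + s ≡ + 2 * (+ 10 + + i) - + t
    s≡2J-t = trans (lem (+ t) (+ s)) (cong (λ x → x - + t)
      (trans (cong +_ t+s≡2J) (trans (ℤ.pos-* 2 J) (cong (λ x → + 2 * x) +J))))
      where
      lem : ∀ t s → s ≡ t + s - t
      lem = solve-∀
    lower : ∀ i t → let J = + 10 + i in
      (t - J + + 6) * (t - J + + 6) + (i * i + + 21 * i + + 3) ≡
      J * (+ 5 * J + + 3) + t * + 2 - + 96 +
        ((t + + 5) * (t + + 5) - ((J * (+ 5 * J + + 3) + t * + 2 + + 14) * J - + 5 * (J * J * J)))
    lower = solve-∀
    upper : ∀ i t → let J = + 10 + i in
      t * (+ 2 * J - t) + + 8 * (+ 2 * J - t) + (+ 8 * i * i + + 161 * i + + 689) ≡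
      J * (+ 5 * J + + 3) + t * + 2 - + 96 -
        ((t + + 5) * (t + + 5) - ((J * (+ 5 * J + + 3) + t * + 2 + + 14) * J - + 5 * (J * J * J)))
    upper = solve-∀
    ε-bound : ∣ (α t + β t) - w J n ∣ ℕ.≤ 60
    ε-bound = ℕ.≤-trans (ℤ.∣i-j∣≤∣i∣+∣j∣ (α t + β t) (w J n)) (ℕ.+-mono-≤ (∣α+β∣≤24 t) (∣w∣≤36 J n))
    V≡U+ε : V J n ≡ U (+ J) + ((α t + β t) - w J n)
    V≡U+ε = begin
      (shift (e J) ρ n - shift (e′ J) ρ n) - W J n
        ≡⟨ cong₂ _-_ (cong₂ _-_ (shift-+ (e J) ρ t) (shift-< ρ (ℕ.+-monoʳ-< (e J) t<2J+1)))
             (W≡P+w J J t) ⟩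
      (ρ t - 0ℤ) - (P (+ J) (2n (+ J) (+ t)) + w J n)
        ≡⟨ lem ((+ t + + 5) * (+ t + + 5)) (α t + β t) (P (+ J) (2n (+ J) (+ t))) (w J n) ⟩
      U (+ J) + ((α t + β t) - w J n) ∎
      where
      open ≡-Reasoning
      lem : ∀ x d p w → (x + d - 0ℤ) - (p + w) ≡ x - p + (d - w)
      lem = solve-∀

  φ≥0-< : t ℕ.< 2 ℕ.* J ℕ.+ 1 → 0ℤ ≤ φ J n
  φ≥0-< t<2J+1 = 0≤-by
    (pos t ⊗ pos t ⊕ pos 10 ⊗ pos t ⊕ pos 1 ⊕ ∣i∣≤c⇒0≤c+i {α t + β t} (∣α+β∣≤24 t))
    (trans (lem (+ t) (α t + β t))
      (sym (cong₂ _-_ (shift-+ (e J) ρ t) (shift-< ρ (ℕ.+-monoʳ-< (e J) t<2J+1)))))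
    where
    lem : ∀ t d → t * t + + 10 * t + + 1 + (+ 24 + d) ≡ (t + + 5) * (t + + 5) + d - 0ℤ
    lem = solve-∀

module _ {J i : ℕ} (J≡10+i : J ≡ 10 ℕ.+ i) (m : ℕ) where
  private
    t n : ℕ
    t = 2 ℕ.* J ℕ.+ 1 ℕ.+ m
    n = e J ℕ.+ t

  n≡e′+m : n ≡ e′ J ℕ.+ m
  n≡e′+m = sym (ℕ.+-assoc (e J) (2 ℕ.* J ℕ.+ 1) m)

  +t : + t ≡ + 2 * + J + + 1 + + m
  +t = cong (λ x → x + + 1 + + m) (ℤ.pos-* 2 J)

  φ≡W+W : φ J n ≡ W J n + W (suc J) n
  φ≡W+W = subst (λ n → φ J n ≡ W J n + W (suc J) n) (sym n≡e′+m) (φ-telescopes J m)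

  -- From `e′ J` on the telescoping identity also holds at J, so the defect is `W (suc J) n`.
  V-bound-≥ : t ℕ.< 5 ℕ.* J ℕ.+ 4 →
    ∃₂ λ U ε → V J n ≡ U + ε × ∣ ε ∣ ℕ.≤ 60 × Dominated (+ J) (+ t) U
  V-bound-≥ t<5J+4 with r , eq ← ℕ.m≤n⇒∃[o]m+o≡n (subst (suc t ℕ.≤_) (ℕ.+-comm (5 ℕ.* J) 4) t<5J+4) =
    U (+ J) (+ t) , w (suc J) n , V≡U+w , ℕ.≤-trans (∣w∣≤36 (suc J) n) (ℕ.m≤m+n 36 24) ,
    subst (λ T → Dominated (+ J) T (U (+ J) T)) (sym +t)
      (subst (λ j → Dominated j (+ 2 * j + + 1 + + m) (U j (+ 2 * j + + 1 + + m))) (sym +J)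
        ( 0≤-by (pos 2 ⊗ pos i ⊗ pos i ⊕ pos 55 ⊗ pos i ⊕ pos 267
                  ⊕ pos 2 ⊗ pos m ⊗ (pos 10 ⊕ pos i) ⊕ pos 4 ⊗ pos m)
            (lower (+ i) (+ m))
        -- Here n < e (J+1) enters: with r = 5J + 3 - t the target is 2J^2 - 5J - 105 + 2rJ.
        , 0≤-by (pos 2 ⊗ pos i ⊗ pos i ⊕ pos 35 ⊗ pos i ⊕ pos 45 ⊕ pos 2 ⊗ pos r ⊗ (pos 10 ⊕ pos i))
            (trans (cong (λ x → + 2 * + i * + i + + 35 * + i + + 45 + + 2 * x * (+ 10 + + i)) r≡3J+2-m)
                   (upper (+ i) (+ m)))))
    where
    +J : + J ≡ + 10 + + i
    +J = cong +_ J≡10+i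
    U : ℤ → ℤ → ℤ
    U j T = P (+ 1 + j) (2n j T)
    r≡3J+2-m : + r ≡ + 3 * (+ 10 + + i) + + 2 - + m
    r≡3J+2-m = begin
      + r
        ≡⟨ lem₁ (+ t) (+ r) ⟩
      + 1 + + t + + r - (+ 1 + + t)
        ≡⟨ cong₂ (λ x y → x - (+ 1 + y)) (cong +_ eq) +t ⟩
      + 4 + + (5 ℕ.* J) - (+ 1 + (+ 2 * + J + + 1 + + m))
        ≡⟨ cong (λ x → + 4 + x - (+ 1 + (+ 2 * + J + + 1 + + m))) (ℤ.pos-* 5 J) ⟩
      + 4 + + 5 * + J - (+ 1 + (+ 2 * + J + + 1 + + m))
        ≡⟨ lem₂ (+ J) (+ m) ⟩
      + 3 * + J + + 2 - + m
        ≡⟨ cong (λ j → + 3 * j + + 2 - + m) +J ⟩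
      + 3 * (+ 10 + + i) + + 2 - + m ∎
      where
      open ≡-Reasoning
      lem₁ : ∀ t r → r ≡ + 1 + t + r - (+ 1 + t)
      lem₁ = solve-∀
      lem₂ : ∀ j m → + 4 + + 5 * j - (+ 1 + (+ 2 * j + + 1 + m)) ≡ + 3 * j + + 2 - m
      lem₂ = solve-∀
    V≡U+w : V J n ≡ U (+ J) (+ t) + w (suc J) n
    V≡U+w = trans (cong (_- W J n) φ≡W+W) (trans (lem (W J n) (W (suc J) n)) (W≡P+w (suc J) J t))
      where
      lem : ∀ x y → x + y - x ≡ y
      lem = solve-∀
    lower : ∀ i m → let J = + 10 + i; T = + 2 * J + + 1 + m in
      + 2 * i * i + + 55 * i + + 267 + + 2 * m * J + + 4 * m ≡
      J * (+ 5 * J + + 3) + T * + 2 - + 96 +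
        ((J * (+ 5 * J + + 3) + T * + 2 + + 14) * (+ 1 + J) - + 5 * ((+ 1 + J) * (+ 1 + J) * (+ 1 + J)))
    lower = solve-∀
    upper : ∀ i m → let J = + 10 + i; T = + 2 * J + + 1 + m in
      + 2 * i * i + + 35 * i + + 45 + + 2 * (+ 3 * J + + 2 - m) * J ≡
      J * (+ 5 * J + + 3) + T * + 2 - + 96 -
        ((J * (+ 5 * J + + 3) + T * + 2 + + 14) * (+ 1 + J) - + 5 * ((+ 1 + J) * (+ 1 + J) * (+ 1 + J)))
    upper = solve-∀

  φ≥0-≥ : 0ℤ ≤ φ J n
  φ≥0-≥ = subst (0ℤ ≤_) (sym (trans φ≡W+W (cong₂ _+_ (W≡P+w J J t) (W≡P+w (suc J) J t))))
    (0≤-by (poly (+ J) (cong +_ J≡10+i) (+ t) +t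
             ⊕ ∣i∣≤c⇒0≤c+i {w J n} (∣w∣≤36 J n) ⊕ ∣i∣≤c⇒0≤c+i {w (suc J) n} (∣w∣≤36 (suc J) n))
      (lem (P (+ J) (2n (+ J) (+ t))) (P (+ suc J) (2n (+ J) (+ t))) (w J n) (w (suc J) n)))
    where
    poly : ∀ j → j ≡ + 10 + + i → ∀ T → T ≡ + 2 * j + + 1 + + m →
           0ℤ ≤ P j (2n j T) + P (+ 1 + j) (2n j T) - + 72
    poly j refl T refl = 0≤-by
      (pos 579 ⊕ pos 42 ⊗ (pos i ⊕ pos m) ⊕ pos 2 ⊗ pos i ⊗ (pos 31 ⊕ pos 2 ⊗ pos i ⊕ pos 2 ⊗ pos m))
      (lem′ (+ i) (+ m))
      where
      lem′ : ∀ i m → let J = + 10 + i; T = + 2 * J + + 1 + m in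
        + 579 + + 42 * (i + m) + + 2 * i * (+ 31 + + 2 * i + + 2 * m) ≡
        ((J * (+ 5 * J + + 3) + T * + 2 + + 14) * J - + 5 * (J * J * J))
        + ((J * (+ 5 * J + + 3) + T * + 2 + + 14) * (+ 1 + J) - + 5 * ((+ 1 + J) * (+ 1 + J) * (+ 1 + J)))
        - + 72
      lem′ = solve-∀
    lem : ∀ p p′ w w′ → p + p′ - + 72 + (+ 36 + w) + (+ 36 + w′) ≡ p + w + (p′ + w′)
    lem = solve-∀

V-bound : ∀ {J i} → J ≡ 10 ℕ.+ i → ∀ t → t ℕ.< 5 ℕ.* J ℕ.+ 4 →
  ∃₂ λ U ε → V J (e J ℕ.+ t) ≡ U + ε × ∣ ε ∣ ℕ.≤ 60 × Dominated (+ J) (+ t) U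
V-bound {J} J≡10+i t t<5J+4 with 2 ℕ.* J ℕ.+ 1 ℕ.≤? t
... | no t≱2J+1 = V-bound-< J≡10+i t (ℕ.≰⇒> t≱2J+1)
... | yes 2J+1≤t with m , refl ← ℕ.m≤n⇒∃[o]m+o≡n 2J+1≤t = V-bound-≥ J≡10+i m t<5J+4

φ≥0 : ∀ {J i} → J ≡ 10 ℕ.+ i → ∀ t → 0ℤ ≤ φ J (e J ℕ.+ t)
φ≥0 {J} J≡10+i t with 2 ℕ.* J ℕ.+ 1 ℕ.≤? t
... | no t≱2J+1 = φ≥0-< J≡10+i t (ℕ.≰⇒> t≱2J+1)
... | yes 2J+1≤t with m , refl ← ℕ.m≤n⇒∃[o]m+o≡n 2J+1≤t = φ≥0-≥ J≡10+i m

-- Downward induction on the index, and the conclusion.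

e′≤e-suc : ∀ k → e′ k ℕ.≤ e (suc k)
e′≤e-suc k = ℕ.+-monoʳ-≤ (e k) (ℕ.+-mono-≤ (ℕ.*-monoˡ-≤ k (ℕ.m≤m+n 2 3)) (ℕ.m≤m+n 1 3))

φ-telescopes-below : ∀ {k J n} → k ℕ.< J → e J ℕ.≤ n → φ k n ≡ W k n + W (suc k) n
φ-telescopes-below {k} k<J eJ≤n
  with m , refl ← ℕ.m≤n⇒∃[o]m+o≡n (ℕ.≤-trans (e′≤e-suc k) (ℕ.≤-trans (e-mono k<J) eJ≤n)) =
  φ-telescopes k m

-- Going down from J, φ k = W k + W (k+1) cancels the `W` of the step above and flips the sign of
-- `V`. The sign is (-1)^(J-k), but both values are bounded alike.
Γ≡W±V : ∀ i k {J n} → k ℕ.+ i ≡ J → e J ℕ.≤ n → n ℕ.< e (suc J) →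
        Γ k n ≡ W k n + V J n ⊎ Γ k n ≡ W k n - V J n
Γ≡W±V zero k {n = n} k+0≡J _ n<e =
  base (trans (sym (ℕ.+-identityʳ k)) k+0≡J) n<e
  where
  lem : ∀ x y → x - 0ℤ ≡ y + (x - y)
  lem = solve-∀
  base : ∀ {J} → k ≡ J → n ℕ.< e (suc J) →
         Γ k n ≡ W k n + V J n ⊎ Γ k n ≡ W k n - V J n
  base refl n<e = inj₁ (trans (Γ≡φ-Γ k n)
    (trans (cong (λ x → φ k n - x) (Γ-< (suc k) n<e)) (lem (φ k n) (W k n))))
Γ≡W±V (suc i) k {J} {n} k+1+i≡J e≤n n<e = step (Γ≡W±V i (suc k) 1+k+i≡J e≤n n<e)
  where
  1+k+i≡J : suc k ℕ.+ i ≡ J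
  1+k+i≡J = trans (sym (ℕ.+-suc k i)) k+1+i≡J
  Γ-step : ∀ {z} → Γ (suc k) n ≡ z → Γ k n ≡ W k n + W (suc k) n - z
  Γ-step {z} Γ≡z = trans (Γ≡φ-Γ k n)
    (cong₂ _-_ (φ-telescopes-below (subst (suc k ℕ.≤_) 1+k+i≡J (ℕ.m≤m+n (suc k) i)) e≤n) Γ≡z)
  lem₁ : ∀ x y v → x + y - (y + v) ≡ x - v
  lem₁ = solve-∀
  lem₂ : ∀ x y v → x + y - (y - v) ≡ x + v
  lem₂ = solve-∀
  step : Γ (suc k) n ≡ W (suc k) n + V J n ⊎ Γ (suc k) n ≡ W (suc k) n - V J n →
         Γ k n ≡ W k n + V J n ⊎ Γ k n ≡ W k n - V J n
  step (inj₁ eq) = inj₂ (trans (Γ-step eq) (lem₁ (W k n) (W (suc k) n) (V J n)))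
  step (inj₂ eq) = inj₁ (trans (Γ-step eq) (lem₂ (W k n) (W (suc k) n) (V J n)))

-- Adds four nonnegative quantities: P k - 2n, 2n - 96 ± U, 36 + w and 60 ± ε; the constants cancel.
W±V≥0 : ∀ x y t {J i} → let k = suc x; n = e J ℕ.+ t in suc (k ℕ.+ y) ≡ J →
  J ≡ 10 ℕ.+ i → t ℕ.< 5 ℕ.* J ℕ.+ 4 → 0ℤ ≤ W k n + V J n × 0ℤ ≤ W k n - V J n
W±V≥0 x y t {J} 1+k+y≡J J≡10+i t<5J+4 = bounds
  (subst (λ J → 0ℤ ≤ P (+ k) (2n (+ J) (+ t)) - 2n (+ J) (+ t)) 1+k+y≡J (P-lower x y t))
  (V-bound J≡10+i t t<5J+4)
  where
  k n : ℕ
  k = suc x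
  n = e J ℕ.+ t
  p l : ℤ
  p = P (+ k) (2n (+ J) (+ t))
  l = 2n (+ J) (+ t)
  36+w : 0ℤ ≤ + 36 + w k n
  36+w = ∣i∣≤c⇒0≤c+i {w k n} (∣w∣≤36 k n)
  lem₁ : ∀ p l u w ε → p - l + (l - + 96 + u) + (+ 36 + w) + (+ 60 + ε) ≡ p + w + (u + ε)
  lem₁ = solve-∀
  lem₂ : ∀ p l u w ε → p - l + (l - + 96 - u) + (+ 36 + w) + (+ 60 - ε) ≡ p + w - (u + ε)
  lem₂ = solve-∀
  bounds : 0ℤ ≤ p - l →
    (∃₂ λ U ε → V J n ≡ U + ε × ∣ ε ∣ ℕ.≤ 60 × Dominated (+ J) (+ t) U) →
    0ℤ ≤ W k n + V J n × 0ℤ ≤ W k n - V J n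
  bounds L≤P (U , ε , V≡U+ε , ∣ε∣≤60 , L+U , L-U) =
    0≤-by (L≤P ⊕ L+U ⊕ 36+w ⊕ ∣i∣≤c⇒0≤c+i {ε} ∣ε∣≤60)
      (trans (lem₁ p l U (w k n) ε) (sym (cong₂ _+_ (W≡P+w k J t) V≡U+ε))) ,
    0≤-by (L≤P ⊕ L-U ⊕ 36+w ⊕ ∣i∣≤c⇒0≤c-i {ε} ∣ε∣≤60)
      (trans (lem₂ p l U (w k n) ε) (sym (cong₂ _-_ (W≡P+w k J t) V≡U+ε)))

n≡e+t : ∀ n → ∃₂ λ J t → n ≡ e J ℕ.+ t × t ℕ.< 5 ℕ.* J ℕ.+ 4
n≡e+t zero = 0 , 0 , refl , s≤s z≤n
n≡e+t (suc n) with J , t , refl , t<5J+4 ← n≡e+t n | suc t ℕ.<? 5 ℕ.* J ℕ.+ 4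
... | yes 1+t<5J+4 = J , suc t , sym (ℕ.+-suc (e J) t) , 1+t<5J+4
... | no 1+t≮5J+4 = suc J , 0 ,
  trans (sym (ℕ.+-suc (e J) t)) (trans
    (cong (e J ℕ.+_) (ℕ.≤-antisym t<5J+4 (ℕ.≮⇒≥ 1+t≮5J+4)))
    (sym (ℕ.+-identityʳ (e (suc J))))) ,
  ℕ.m≤n⇒m≤o+n (5 ℕ.* suc J) (s≤s z≤n)

-- For k < J the bounds on `W` and `V` apply; for k = J only `φ J n` is left; for k > J the series
-- has not begun.
Γ≥0-large : ∀ x {J i} t → J ≡ 10 ℕ.+ i → t ℕ.< 5 ℕ.* J ℕ.+ 4 → 0ℤ ≤ Γ (suc x) (e J ℕ.+ t)
Γ≥0-large x {J} t J≡10+i t<5J+4 = cases (ℕ.<-cmp (suc x) J)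
  where
  n : ℕ
  n = e J ℕ.+ t
  n<e : n ℕ.< e (suc J)
  n<e = ℕ.+-monoʳ-< (e J) t<5J+4
  last : ∀ {k} → k ≡ J → 0ℤ ≤ Γ k n
  last refl = 0≤-by (φ≥0 J≡10+i t) (sym (trans (Γ≡φ-Γ J n)
    (trans (cong (λ z → φ J n - z) (Γ-< (suc J) n<e)) (ℤ.+-identityʳ (φ J n)))))
  signs : Γ (suc x) n ≡ W (suc x) n + V J n ⊎ Γ (suc x) n ≡ W (suc x) n - V J n →
          0ℤ ≤ W (suc x) n + V J n × 0ℤ ≤ W (suc x) n - V J n → 0ℤ ≤ Γ (suc x) n
  signs (inj₁ eq) (W+V≥0 , _) = 0≤-by W+V≥0 (sym eq)
  signs (inj₂ eq) (_ , W-V≥0) = 0≤-by W-V≥0 (sym eq)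
  earlier : ∃[ y ] suc (suc x) ℕ.+ y ≡ J → 0ℤ ≤ Γ (suc x) n
  earlier (y , eq) = signs
    (Γ≡W±V (suc y) (suc x) (trans (ℕ.+-suc (suc x) y) eq) (ℕ.m≤m+n (e J) t) n<e)
    (W±V≥0 x y t eq J≡10+i t<5J+4)
  cases : Tri (suc x ℕ.< J) (suc x ≡ J) (J ℕ.< suc x) → 0ℤ ≤ Γ (suc x) n
  cases (tri< k<J _ _) = earlier (ℕ.m≤n⇒∃[o]m+o≡n k<J)
  cases (tri≈ _ k≡J _) = last k≡J
  cases (tri> _ _ J<k) = ℤ.≤-reflexive (sym (Γ-< (suc x) (ℕ.<-≤-trans n<e (e-mono J<k))))

Γ≥0 : ∀ x n → 0ℤ ≤ Γ (suc x) n
Γ≥0 x n = decompose (n≡e+t n)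
  where
  decompose : (∃₂ λ J t → n ≡ e J ℕ.+ t × t ℕ.< 5 ℕ.* J ℕ.+ 4) → 0ℤ ≤ Γ (suc x) n
  decompose (J , t , refl , t<5J+4) = cases (10 ℕ.≤? J)
    where
    large : ∃[ i ] 10 ℕ.+ i ≡ J → 0ℤ ≤ Γ (suc x) n
    large (i , 10+i≡J) = Γ≥0-large x t (sym 10+i≡J) t<5J+4
    cases : Dec (10 ℕ.≤ J) → 0ℤ ≤ Γ (suc x) n
    cases (yes 10≤J) = large (ℕ.m≤n⇒∃[o]m+o≡n 10≤J)
    cases (no 10≰J)  = Γ≥0-small x
      (ℕ.<-≤-trans (ℕ.+-monoʳ-< (e J) t<5J+4) (e-mono (ℕ.≰⇒> 10≰J)))

corollary2p6 : ∀ (k n : ℕ) → 1 ℕ.≤ k → 0ℤ ℤ.≤ γ 1 4 5 5/2 3/2 exponents k n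
corollary2p6 (suc x) n _ = ℤ.*-cancelˡ-≤-pos 0ℤ (γ 1 4 5 5/2 3/2 exponents (suc x) n) (+ 40)
  (subst (_≤ Γ (suc x) n) (sym (ℤ.*-zeroʳ (+ 40))) (Γ≥0 x n))
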